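{- For every GKAT expression $e\in\mathrm{Exp}$, the Thompson automaton $\mathcal{X}_e^\iota$ for $e$ is effectively constructible in time $O(|e|)$ and has $\#_\Sigma(e)+1$ (thus $O(|e|)$) states, where $|\mathrm{At}|$ is considered a constant for the time complexity claim, $|e|$ denotes the size of the expression $e$, and $\#_\Sigma(e)$ denotes the number of occurrences of actions in $e$.
   Context: Syntax. Fix disjoint nonempty sets $\Sigma$ (actions) and $T=\{t_1,\dots,t_n\}$ (primitive tests), $T$ finite. Boolean expressions $b,c\in\mathrm{BExp}$ are generated by $0 \mid 1 \mid t\in T \mid b\cdot c \mid b+c \mid \overline{b}$. GKAT expressions $e,f\in\mathrm{Exp}$ are generated by $p\in\Sigma \mid b\in\mathrm{BExp} \mid e\cdot f \mid e+_b f \mid e^{(b)}$. $\equiv_{BA}$ denotes Boolean equivalence, $b\le c$ iff $b+c\equiv_{BA}c$. $\mathrm{At}$ is the finite set of atoms (minimal nonzero elements) of the free Boolean algebra $\mathrm{BExp}/{\equiv_{BA}}$ on $T$. Automata. Let $GX=(2+\Sigma\times X)^{\mathrm{At}}$ with $2=\{0,1\}$. A $G$-coalgebra is a pair $\mathcal{X}=\langle X,\delta^{\mathcal{X}}\rangle$ with $\delta^{\mathcal{X}}:X\to GX$; a $G$-automaton is a $G$-coalgebra with a designated start state. Thompson construction. For $\langle X,\delta\rangle$, $Y\subseteq X$, $h\in GX$, the uniform continuation $\delta[Y,h]:X\to GX$ is $\delta[Y,h](x)(\alpha)=h(\alpha)$ if $x\in Y$ and $\delta(x)(\alpha)=1$,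 and $\delta[Y,h](x)(\alpha)=\delta(x)(\alpha)$ otherwise. $\delta_1+\delta_2$ denotes the coproduct structure on the disjoint union $X+Y$. For each $e\in\mathrm{Exp}$ define a $G$-coalgebra $\mathcal{X}_e=\langle X_e,\delta_e\rangle$ and an initial pseudostate $\iota_e\in GX_e$ by recursion: - $e=b$: $X_b=\emptyset$, $\iota_b(\alpha)=1$ if $\alpha\le b$, else $0$. - $e=p$: $X_p=\{*\}$, $\delta_p(*)(\alpha)=1$ for all $\alpha$, $\iota_p(\alpha)=(p,*)$. - $e=f+_bg$: $X_e=X_f+X_g$, $\delta_e=\delta_f+\delta_g$, $\iota_e(\alpha)=\iota_f(\alpha)$ if $\alpha\le b$, $\iota_g(\alpha)$ if $\alpha\le\overline{b}$. - $e=f\cdot g$: $X_e=X_f+X_g$, $\delta_e=(\delta_f+\delta_g)[X_f,\iota_g]$, $\iota_e(\alpha)=\iota_f(\alpha)$ if $\iota_f(\alpha)\ne1$, $\iota_g(\alpha)$ if $\iota_f(\alpha)=1$. - $e=f^{(b)}$: $X_e=X_f$, $\iota_e(\alpha)=1$ if $\alpha\le\overline{b}$; $0$ if $\alpha\le b$ and $\iota_f(\alpha)=1$; $\iota_f(\alpha)$ if $\alpha\le b$ and $\iota_f(\alpha)\ne1$; $\delta_e=\delta_f[X_f,\iota_e]$. The Thompson automaton is $\mathcal{X}_e^\iota=\langle\{\iota\}+X_e,\delta_e^\iota,\iota\rangle$ with $\delta_e^\iota(x)=\delta_e(x)$ for $x\in X_e$ and $\delta_e^\iota(\iota)=\iota_e$.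 -}

module Defs where

open import Data.Bool.Base using (Bool; true; false; T; not; _∧_; _∨_; if_then_else_)
import Data.Bool.Properties as Boolₚ
open import Data.Empty using (⊥; ⊥-elim)
open import Data.Fin.Base using (Fin; zero; suc; toℕ)
open import Data.List.Base using (List; []; _∷_; map; foldr; tabulate; _++_)
open import Data.List.Membership.Propositional using (_∈_)
open import Data.List.Membership.Propositional.Properties using (∈-map⁺; ∈-map⁻; ∈-++⁺ˡ; ∈-++⁺ʳ)
open import Data.List.Relation.Unary.Any using (here)
open import Data.List.Relation.Unary.Unique.Propositional using (Unique)
open import Data.List.Relation.Unary.Unique.Propositional.Properties using (map⁺; ++⁺)
import Data.List.Relation.Unary.AllPairs as AllPairs
import Data.List.Relation.Unary.All as All
open import Data.Nat.Base using (ℕ; zero; suc; _+_)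
open import Data.Product.Base using (Σ-syntax; _×_; _,_; proj₁; proj₂)
open import Data.Sum.Base as Sum using (_⊎_; inj₁; inj₂)
open import Data.Unit.Base using (⊤; tt)
open import Data.Vec.Base as Vec using (Vec; []; _∷_; lookup; allFin)
import Data.Vec.Properties as Vecₚ
open import Algebra.Lattice.Bundles using (BooleanAlgebra)
open import Algebra.Lattice.Structures.Biased using (isBooleanAlgebraʳ; isDistributiveLatticeʳʲᵐ)
import Algebra.Lattice.Properties.BooleanAlgebra as BAₚ
open import Function.Base using (id; _∘_; const)
open import Function.Bundles using (_↔_; Inverse; Equivalence)
open import Relation.Binary.PropositionalEquality as ≡ using (_≡_; refl; cong; cong₂; subst)
open import Relation.Nullary using (¬_; Dec; does; yes; no)
open import Relation.Nullary.Decidable using (map′; T?)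

infixr 7 _·ᴮ_
infixr 6 _+ᴮ_
infix  4 _≡BA_ _≤BA_

-- T = {t₁, …, tₙ} is Fin n.
data BExp (n : ℕ) : Set where
  0ᴮ 1ᴮ     : BExp n
  prim      : Fin n → BExp n
  _·ᴮ_ _+ᴮ_ : BExp n → BExp n → BExp n
  !_        : BExp n → BExp n

-- Provability from the axioms of Boolean algebra, so that BExp n modulo
-- _≡BA_ is the free Boolean algebra on n generators.
data _≡BA_ {n : ℕ} : BExp n → BExp n → Set where
  ≡refl    : ∀ {a} → a ≡BA a
  ≡sym     : ∀ {a b} → a ≡BA b → b ≡BA a
  ≡trans   : ∀ {a b c} → a ≡BA b → b ≡BA c → a ≡BA c
  +-cong   : ∀ {a a′ b b′} → a ≡BA a′ → b ≡BA b′ → a +ᴮ b ≡BA a′ +ᴮ b′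
  ·-cong   : ∀ {a a′ b b′} → a ≡BA a′ → b ≡BA b′ → a ·ᴮ b ≡BA a′ ·ᴮ b′
  !-cong   : ∀ {a a′} → a ≡BA a′ → ! a ≡BA ! a′
  +-comm   : ∀ a b → a +ᴮ b ≡BA b +ᴮ a
  ·-comm   : ∀ a b → a ·ᴮ b ≡BA b ·ᴮ a
  +-assoc  : ∀ a b c → (a +ᴮ b) +ᴮ c ≡BA a +ᴮ (b +ᴮ c)
  ·-assoc  : ∀ a b c → (a ·ᴮ b) ·ᴮ c ≡BA a ·ᴮ (b ·ᴮ c)
  +-absorb : ∀ a b → a +ᴮ (a ·ᴮ b) ≡BA a
  ·-absorb : ∀ a b → a ·ᴮ (a +ᴮ b) ≡BA a
  +-distʳ  : ∀ a b c → (b ·ᴮ c) +ᴮ a ≡BA (b +ᴮ a) ·ᴮ (c +ᴮ a)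
  +-compl  : ∀ a → a +ᴮ (! a) ≡BA 1ᴮ
  ·-compl  : ∀ a → a ·ᴮ (! a) ≡BA 0ᴮ

_≤BA_ : ∀ {n} → BExp n → BExp n → Set
b ≤BA c = b +ᴮ c ≡BA c

freeBA : ℕ → BooleanAlgebra _ _
freeBA n = record
  { Carrier = BExp n ; _≈_ = _≡BA_ ; _∨_ = _+ᴮ_ ; _∧_ = _·ᴮ_ ; ¬_ = !_ ; ⊤ = 1ᴮ ; ⊥ = 0ᴮ
  ; isBooleanAlgebra = isBooleanAlgebraʳ (record
    { isDistributiveLattice = isDistributiveLatticeʳʲᵐ (record
      { isLattice = record
        { isEquivalence = record { refl = ≡refl ; sym = ≡sym ; trans = ≡trans }
        ; ∨-comm = +-comm ; ∨-assoc = +-assoc ; ∨-cong = +-cong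
        ; ∧-comm = ·-comm ; ∧-assoc = ·-assoc ; ∧-cong = ·-cong
        ; absorptive = +-absorb , ·-absorb
        }
      ; ∨-distribʳ-∧ = +-distʳ
      })
    ; ∨-complementʳ = +-compl
    ; ∧-complementʳ = ·-compl
    ; ¬-cong = !-cong
    })
  }

IsAtom : ∀ {n} → BExp n → Set
IsAtom {n} a = ¬ (a ≡BA 0ᴮ) × (∀ (c : BExp n) → c ≤BA a → (c ≡BA 0ᴮ) ⊎ (c ≡BA a))

-- An atom is determined by the sign with which each primitive test occurs
-- in it.  That ⌜_⌝ is a bijection from At n onto the minimal nonzero
-- elements modulo _≡BA_ is ⌜⌝-isAtom, ⌜⌝-injective and ⌜⌝-surjective below.
At : ℕ → Set
At n = Vec Bool n

literal : ∀ {n} → BExp n → Bool → BExp n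
literal b v = if v then b else (! b)

conj : ∀ {n m} → Vec (Fin n) m → Vec Bool m → BExp n
conj []       []       = 1ᴮ
conj (t ∷ ts) (v ∷ vs) = literal (prim t) v ·ᴮ conj ts vs

⌜_⌝ : ∀ {n} → At n → BExp n
⌜_⌝ {n} α = conj (allFin n) α

eval : ∀ {n} → At n → BExp n → Bool
eval α 0ᴮ       = false
eval α 1ᴮ       = true
eval α (prim t) = lookup α t
eval α (b ·ᴮ c) = eval α b ∧ eval α c
eval α (b +ᴮ c) = eval α b ∨ eval α c
eval α (! b)    = not (eval α b)

eval-cong : ∀ {n} (α : At n) {b c} → b ≡BA c → eval α b ≡ eval α c
eval-cong α ≡refl          = refl
eval-cong α (≡sym p)       = ≡.sym (eval-cong α p)
eval-cong α (≡trans p q)   = ≡.trans (eval-cong α p) (eval-cong α q)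
eval-cong α (+-cong p q)   = cong₂ _∨_ (eval-cong α p) (eval-cong α q)
eval-cong α (·-cong p q)   = cong₂ _∧_ (eval-cong α p) (eval-cong α q)
eval-cong α (!-cong p)     = cong not (eval-cong α p)
eval-cong α (+-comm a b)   = Boolₚ.∨-comm (eval α a) (eval α b)
eval-cong α (·-comm a b)   = Boolₚ.∧-comm (eval α a) (eval α b)
eval-cong α (+-assoc a b c) = Boolₚ.∨-assoc (eval α a) (eval α b) (eval α c)
eval-cong α (·-assoc a b c) = Boolₚ.∧-assoc (eval α a) (eval α b) (eval α c)
eval-cong α (+-absorb a b) = Boolₚ.∨-abs-∧ (eval α a) (eval α b)
eval-cong α (·-absorb a b) = Boolₚ.∧-abs-∨ (eval α a) (eval α b)
eval-cong α (+-distʳ a b c) = Boolₚ.∨-distribʳ-∧ (eval α a) (eval α b) (eval α c)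
eval-cong α (+-compl a)    = Boolₚ.∨-inverseʳ (eval α a)
eval-cong α (·-compl a)    = Boolₚ.∧-inverseʳ (eval α a)

module _ {n : ℕ} where
  private
    module B where
      open BooleanAlgebra (freeBA n) public
      open BAₚ (freeBA n) public
    variable
      a b c d : BExp n

  ≤-refl : a ≤BA a
  ≤-refl {a} = B.∨-idem a

  ≤-trans : a ≤BA b → b ≤BA c → a ≤BA c
  ≤-trans {a} {b} {c} p q =
    ≡trans (+-cong ≡refl (≡sym q))
      (≡trans (≡sym (+-assoc a b c)) (≡trans (+-cong p ≡refl) q))

  ≤-antisym : a ≤BA b → b ≤BA a → a ≡BA b
  ≤-antisym {a} {b} p q = ≡trans (≡sym q) (≡trans (+-comm b a) p)

  ≤-reflexive : a ≡BA b → a ≤BA b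
  ≤-reflexive {a} {b} p = ≡trans (+-cong p ≡refl) (B.∨-idem b)

  ≤-+ˡ : a ≤BA b → a ≤BA (b +ᴮ c)
  ≤-+ˡ {a} {b} {c} p = ≡trans (≡sym (+-assoc a b c)) (+-cong p ≡refl)

  ≤-+ʳ : a ≤BA c → a ≤BA (b +ᴮ c)
  ≤-+ʳ {b = b} p = ≤-trans (≤-+ˡ p) (≤-reflexive (+-comm _ b))

  ≤-· : a ≤BA b → a ≤BA c → a ≤BA (b ·ᴮ c)
  ≤-· {a} {b} {c} p q = ≡trans (B.∨-distribˡ-∧ a b c) (·-cong p q)

  ·-≤ˡ : (a ·ᴮ b) ≤BA a
  ·-≤ˡ {a} {b} = ≡trans (+-comm _ a) (+-absorb a b)

  ·-≤ʳ : (a ·ᴮ b) ≤BA b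
  ·-≤ʳ {a} {b} = ≤-trans (≤-reflexive (·-comm a b)) ·-≤ˡ

  ≤-1 : a ≤BA 1ᴮ
  ≤-1 {a} = B.∨-zeroʳ a

  ≤-contradiction : a ≤BA b → a ≤BA (! b) → a ≡BA 0ᴮ
  ≤-contradiction {a} {b} p q =
    ≡trans (≡sym (B.∨-identityʳ a)) (≡trans (+-cong ≡refl (≡sym (·-compl b))) (≡trans (≤-· p q) (·-compl b)))

  literal-· : ∀ v w → a ≤BA literal b v → a ≤BA literal c w → a ≤BA literal (b ·ᴮ c) (v ∧ w)
  literal-· true  true  p q = ≤-· p q
  literal-· {b = b} {c = c} true  false p q = ≤-trans (≤-+ʳ q) (≤-reflexive (≡sym (B.deMorgan₁ b c)))
  literal-· {b = b} {c = c} false _ p q = ≤-trans (≤-+ˡ p) (≤-reflexive (≡sym (B.deMorgan₁ b c)))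

  literal-+ : ∀ v w → a ≤BA literal b v → a ≤BA literal c w → a ≤BA literal (b +ᴮ c) (v ∨ w)
  literal-+ true  _     p q = ≤-+ˡ p
  literal-+ false true  p q = ≤-+ʳ q
  literal-+ {b = b} {c = c} false false p q = ≤-trans (≤-· p q) (≤-reflexive (≡sym (B.deMorgan₂ b c)))

  literal-! : ∀ v → a ≤BA literal b v → a ≤BA literal (! b) (not v)
  literal-! {b = b} true  p = ≤-trans p (≤-reflexive (≡sym (B.¬-involutive b)))
  literal-! false p = p

  conj-≤ : ∀ {m} (ts : Vec (Fin n) m) vs i → conj ts vs ≤BA literal (prim (lookup ts i)) (lookup vs i)
  conj-≤ (t ∷ ts) (v ∷ vs) zero    = ·-≤ˡ
  conj-≤ (t ∷ ts) (v ∷ vs) (suc i) = ≤-trans ·-≤ʳ (conj-≤ ts vs i)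

  ⌜⌝-≤-literal : ∀ (α : At n) b → ⌜ α ⌝ ≤BA literal b (eval α b)
  ⌜⌝-≤-literal α 0ᴮ       = ≤-trans ≤-1 (≤-reflexive (≡sym B.¬⊥≈⊤))
  ⌜⌝-≤-literal α 1ᴮ       = ≤-1
  ⌜⌝-≤-literal α (prim t) =
    subst (λ s → ⌜ α ⌝ ≤BA literal (prim s) (lookup α t)) (Vecₚ.lookup-allFin t) (conj-≤ (allFin n) α t)
  ⌜⌝-≤-literal α (b ·ᴮ c) = literal-· (eval α b) (eval α c) (⌜⌝-≤-literal α b) (⌜⌝-≤-literal α c)
  ⌜⌝-≤-literal α (b +ᴮ c) = literal-+ (eval α b) (eval α c) (⌜⌝-≤-literal α b) (⌜⌝-≤-literal α c)
  ⌜⌝-≤-literal α (! b)    = literal-! (eval α b) (⌜⌝-≤-literal α b)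

  eval-conj : ∀ (α : At n) {m} (ts : Vec (Fin n) m) → eval α (conj ts (Vec.map (lookup α) ts)) ≡ true
  eval-conj α []       = refl
  eval-conj α (t ∷ ts) with lookup α t in eq
  ... | true  rewrite eq = eval-conj α ts
  ... | false rewrite eq = eval-conj α ts

  eval-⌜⌝ : ∀ (α : At n) → eval α ⌜ α ⌝ ≡ true
  eval-⌜⌝ α = subst (λ β → eval α (conj (allFin n) β) ≡ true) (Vecₚ.map-lookup-allFin α) (eval-conj α (allFin n))

  ≤⇒eval : ∀ (α : At n) {b} → ⌜ α ⌝ ≤BA b → eval α b ≡ true
  ≤⇒eval α {b} p =
    ≡.trans (≡.sym (eval-cong α p)) (cong (_∨ eval α b) (eval-⌜⌝ α))

  eval⇒≤ : ∀ (α : At n) {b} → eval α b ≡ true → ⌜ α ⌝ ≤BA b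
  eval⇒≤ α {b} eq = subst (λ v → ⌜ α ⌝ ≤BA literal b v) eq (⌜⌝-≤-literal α b)

  _≤?_ : ∀ (α : At n) b → Dec (⌜ α ⌝ ≤BA b)
  α ≤? b = map′ (λ t → eval⇒≤ α (Equivalence.to Boolₚ.T-≡ t))
                (λ p → Equivalence.from Boolₚ.T-≡ (≤⇒eval α p))
                (T? (eval α b))

  -- The two cases α ≤ b and α ≤ ! b are exhaustive and mutually exclusive.

  ≰⇒≤! : ∀ (α : At n) {b} → ¬ (⌜ α ⌝ ≤BA b) → ⌜ α ⌝ ≤BA (! b)
  ≰⇒≤! α {b} ≰ with eval α b | ⌜⌝-≤-literal α b
  ... | true  | p = ⊥-elim (≰ p)
  ... | false | p = p

  ⌜⌝-≢0 : ∀ (α : At n) → ¬ (⌜ α ⌝ ≡BA 0ᴮ)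
  ⌜⌝-≢0 α p with ≡.trans (≡.sym (eval-⌜⌝ α)) (eval-cong α p)
  ... | ()

  ≤!⇒≰ : ∀ (α : At n) {b} → ⌜ α ⌝ ≤BA (! b) → ¬ (⌜ α ⌝ ≤BA b)
  ≤!⇒≰ α q p = ⌜⌝-≢0 α (≤-contradiction p q)

  ⌜⌝-isAtom : ∀ (α : At n) → IsAtom ⌜ α ⌝
  ⌜⌝-isAtom α = ⌜⌝-≢0 α , minimal
    where
    minimal : ∀ c → c ≤BA ⌜ α ⌝ → (c ≡BA 0ᴮ) ⊎ (c ≡BA ⌜ α ⌝)
    minimal c c≤α with α ≤? c
    ... | yes α≤c = inj₂ (≤-antisym c≤α α≤c)
    ... | no  α≰c = inj₁ (≤-contradiction ≤-refl (≤-trans c≤α (≰⇒≤! α α≰c)))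

  ⌜⌝-injective : ∀ (α β : At n) → ⌜ α ⌝ ≡BA ⌜ β ⌝ → α ≡ β
  ⌜⌝-injective α β p = ≡.trans (≡.sym (Vecₚ.tabulate∘lookup α))
    (≡.trans (Vecₚ.tabulate-cong agree) (Vecₚ.tabulate∘lookup β))
    where
    agree : ∀ i → lookup α i ≡ lookup β i
    agree i = ≡.sym (lemma (lookup β i) (≤⇒eval α (≤-trans (≤-reflexive p) (⌜⌝-≤-literal β (prim i)))))
      where
      lemma : ∀ v → eval α (literal (prim i) v) ≡ true → v ≡ lookup α i
      lemma true  eq = ≡.sym eq
      lemma false eq = ≡.sym (≡.trans (≡.sym (Boolₚ.not-involutive (lookup α i))) (cong not eq))

  conj-exhaustive : ∀ {m} (ts : Vec (Fin n) m) c → (∀ vs → conj ts vs ≤BA c) → 1ᴮ ≤BA c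
  conj-exhaustive []       c f = f []
  conj-exhaustive (t ∷ ts) c f = conj-exhaustive ts c λ vs →
    let x = conj ts vs ; y = prim t in
    ≤-trans
      (≤-reflexive (≡trans (≡sym (B.∧-identityˡ x))
        (≡trans (·-cong (≡sym (+-compl y)) ≡refl) (B.∧-distribʳ-∨ x y (! y)))))
      (≡trans (+-assoc (y ·ᴮ x) ((! y) ·ᴮ x) c) (≡trans (+-cong ≡refl (f (false ∷ vs))) (f (true ∷ vs))))

atoms : ∀ n → List (At n)
atoms zero    = [] ∷ []
atoms (suc n) = map (false ∷_) (atoms n) ++ map (true ∷_) (atoms n)

∈-atoms : ∀ {n} (α : At n) → α ∈ atoms n
∈-atoms []          = here refl
∈-atoms (false ∷ α) = ∈-++⁺ˡ (∈-map⁺ (false ∷_) (∈-atoms α))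
∈-atoms (true  ∷ α) = ∈-++⁺ʳ (map (false ∷_) (atoms _)) (∈-map⁺ (true ∷_) (∈-atoms α))

atoms-unique : ∀ n → Unique (atoms n)
atoms-unique zero    = All.[] AllPairs.∷ AllPairs.[]
atoms-unique (suc n) =
  ++⁺ (map⁺ Vecₚ.∷-injectiveʳ (atoms-unique n)) (map⁺ Vecₚ.∷-injectiveʳ (atoms-unique n)) disjoint
  where
  disjoint : ∀ {α} → ¬ (α ∈ map (false ∷_) (atoms n) × α ∈ map (true ∷_) (atoms n))
  disjoint (p , q) with ∈-map⁻ (false ∷_) p | ∈-map⁻ (true ∷_) q
  ... | _ , _ , refl | _ , _ , ()

satisfiable? : ∀ {m} (f : Vec Bool m → Bool) → (Σ[ v ∈ Vec Bool m ] f v ≡ true) ⊎ (∀ v → f v ≡ false)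
satisfiable? {zero} f with f [] in eq
... | true  = inj₁ ([] , eq)
... | false = inj₂ λ { [] → eq }
satisfiable? {suc m} f with satisfiable? (f ∘ (true ∷_)) | satisfiable? (f ∘ (false ∷_))
... | inj₁ (v , eq) | _             = inj₁ (true ∷ v , eq)
... | inj₂ _        | inj₁ (v , eq) = inj₁ (false ∷ v , eq)
... | inj₂ p        | inj₂ q        = inj₂ λ { (true ∷ v) → p v ; (false ∷ v) → q v }

⌜⌝-surjective : ∀ {n} (b : BExp n) → IsAtom b → Σ[ α ∈ At n ] ⌜ α ⌝ ≡BA b
⌜⌝-surjective {n} b (b≢0 , minimal) with satisfiable? (λ α → eval α b)
... | inj₁ (α , eq) = α , Sum.[ (λ p → ⊥-elim (⌜⌝-≢0 α p)) , id ] (minimal ⌜ α ⌝ (eval⇒≤ α eq))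
... | inj₂ unsat    = ⊥-elim (b≢0 (≤-contradiction ≤-refl (≤-trans ≤-1 1≤!b)))
  where
  1≤!b : 1ᴮ ≤BA (! b)
  1≤!b = conj-exhaustive (allFin n) (! b) λ α → eval⇒≤ α (cong not (unsat α))

infixr 7 _·_
infixr 6 _+[_]_
infix  8 _^⟨_⟩

-- Act is the set of actions, written Σ in the literature on GKAT.
data Exp (Act : Set) (n : ℕ) : Set where
  act     : Act → Exp Act n
  bool    : BExp n → Exp Act n
  _·_     : Exp Act n → Exp Act n → Exp Act n
  _+[_]_  : Exp Act n → BExp n → Exp Act n → Exp Act n
  _^⟨_⟩   : Exp Act n → BExp n → Exp Act n

-- |e| is the number of nodes of the syntax tree; bool is an embedding of
-- BExp into Exp and is not counted as a node.
sizeᴮ : ∀ {n} → BExp n → ℕ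
sizeᴮ 0ᴮ       = 1
sizeᴮ 1ᴮ       = 1
sizeᴮ (prim t) = 1
sizeᴮ (b ·ᴮ c) = 1 + sizeᴮ b + sizeᴮ c
sizeᴮ (b +ᴮ c) = 1 + sizeᴮ b + sizeᴮ c
sizeᴮ (! b)    = 1 + sizeᴮ b

∣_∣ : ∀ {Act n} → Exp Act n → ℕ
∣ act p ∣      = 1
∣ bool b ∣     = sizeᴮ b
∣ e · f ∣      = 1 + ∣ e ∣ + ∣ f ∣
∣ e +[ b ] f ∣ = 1 + sizeᴮ b + ∣ e ∣ + ∣ f ∣
∣ e ^⟨ b ⟩ ∣   = 1 + sizeᴮ b + ∣ e ∣

-- Number of occurrences of actions.
#Σ : ∀ {Act n} → Exp Act n → ℕ
#Σ (act p)      = 1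
#Σ (bool b)     = 0
#Σ (e · f)      = #Σ e + #Σ f
#Σ (e +[ b ] f) = #Σ e + #Σ f
#Σ (e ^⟨ b ⟩)   = #Σ e

-- 2 = {0, 1} is Bool, with 0 = false (reject) and 1 = true (accept).
Out : Set → Set → Set
Out Act X = Bool ⊎ (Act × X)

pattern reject   = inj₁ false
pattern accept   = inj₁ true
pattern step p x = inj₂ (p , x)

G : Set → ℕ → Set → Set
G Act n X = At n → Out Act X

record Automaton (Act : Set) (n : ℕ) : Set₁ where
  field
    State : Set
    δ     : State → G Act n State
    start : State

mapOut : ∀ {Act X Y} → (X → Y) → Out Act X → Out Act Y
mapOut f (inj₁ v)   = inj₁ v
mapOut f (step p x) = step p (f x)

_⊕_ : ∀ {Act n X Y} → (X → G Act n X) → (Y → G Act n Y) → X ⊎ Y → G Act n (X ⊎ Y)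
(δ₁ ⊕ δ₂) (inj₁ x) α = mapOut inj₁ (δ₁ x α)
(δ₁ ⊕ δ₂) (inj₂ y) α = mapOut inj₂ (δ₂ y α)

_▷_ : ∀ {Act X} → Out Act X → Out Act X → Out Act X
accept   ▷ o = o
reject   ▷ o = reject
step p x ▷ o = step p x

-- The uniform continuation δ[Y,h]; the subset Y is given by its
-- characteristic function.
_[_,_] : ∀ {Act n X} → (X → G Act n X) → (X → Bool) → G Act n X → X → G Act n X
(δ [ Y , h ]) x α = if Y x then δ x α ▷ h α else δ x α

isLeft : ∀ {X Y : Set} → X ⊎ Y → Bool
isLeft (inj₁ _) = true
isLeft (inj₂ _) = false

module _ {Act : Set} {n : ℕ} where

  X⟨_⟩ : Exp Act n → Set
  X⟨ act p ⟩      = ⊤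
  X⟨ bool b ⟩     = ⊥
  X⟨ f · g ⟩      = X⟨ f ⟩ ⊎ X⟨ g ⟩
  X⟨ f +[ b ] g ⟩ = X⟨ f ⟩ ⊎ X⟨ g ⟩
  X⟨ f ^⟨ b ⟩ ⟩   = X⟨ f ⟩

  ι⟨_⟩ : (e : Exp Act n) → G Act n X⟨ e ⟩
  ι⟨ act p ⟩      α = step p tt
  ι⟨ bool b ⟩     α = if does (α ≤? b) then accept else reject
  ι⟨ f · g ⟩      α = mapOut inj₁ (ι⟨ f ⟩ α) ▷ mapOut inj₂ (ι⟨ g ⟩ α)
  ι⟨ f +[ b ] g ⟩ α = if does (α ≤? b) then mapOut inj₁ (ι⟨ f ⟩ α) else mapOut inj₂ (ι⟨ g ⟩ α)
  ι⟨ f ^⟨ b ⟩ ⟩   α = if does (α ≤? b) then ι⟨ f ⟩ α ▷ reject else accept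

  δ⟨_⟩ : (e : Exp Act n) → X⟨ e ⟩ → G Act n X⟨ e ⟩
  δ⟨ act p ⟩      = λ _ _ → accept
  δ⟨ bool b ⟩     = λ ()
  δ⟨ f · g ⟩      = (δ⟨ f ⟩ ⊕ δ⟨ g ⟩) [ isLeft , (λ α → mapOut inj₂ (ι⟨ g ⟩ α)) ]
  δ⟨ f +[ b ] g ⟩ = δ⟨ f ⟩ ⊕ δ⟨ g ⟩
  δ⟨ f ^⟨ b ⟩ ⟩   = δ⟨ f ⟩ [ const true , ι⟨ f ^⟨ b ⟩ ⟩ ]

  δι⟨_⟩ : (e : Exp Act n) → ⊤ ⊎ X⟨ e ⟩ → G Act n (⊤ ⊎ X⟨ e ⟩)
  δι⟨ e ⟩ (inj₁ _) α = mapOut inj₂ (ι⟨ e ⟩ α)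
  δι⟨ e ⟩ (inj₂ x) α = mapOut inj₂ (δ⟨ e ⟩ x α)

  thompson : Exp Act n → Automaton Act n
  thompson e = record { State = ⊤ ⊎ X⟨ e ⟩ ; δ = δι⟨ e ⟩ ; start = inj₁ tt }

-- The machine model: algorithms are first-order functional programs (finitely many mutually
-- recursive functions, call by value) over a data type of pairs, numbers
-- and actions, with one unit of time charged per evaluation step.
-- On numbers only constants, successor, predecessor and test for zero are
-- available; actions can be copied but not inspected.  As a program is
-- fixed, with finitely many variables and constants, each charged step is
-- a bounded number of pointer or register operations of a unit-cost RAM.

infixr 5 _∷ᵥ_

data Val (Act : Set) : Set where
  num  : ℕ → Val Act
  sym  : Act → Val Act
  _∷ᵥ_ : Val Act → Val Act → Val Act

-- Tm ar m: terms with m free variables (de Bruijn indices), calling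
-- functions whose arities are given by ar.
data Tm {F : ℕ} (ar : Fin F → ℕ) (m : ℕ) : Set where
  var   : Fin m → Tm ar m
  num   : ℕ → Tm ar m
  suc   : Tm ar m → Tm ar m
  cons  : Tm ar m → Tm ar m → Tm ar m
  let′  : Tm ar m → Tm ar (1 + m) → Tm ar m
  -- match t z s a c: the branches are for zero, successor (binding the
  -- predecessor), action (binding it), pair (binding head and tail).
  match : Tm ar m → Tm ar m → Tm ar (1 + m) → Tm ar (1 + m) → Tm ar (2 + m) → Tm ar m
  call  : (f : Fin F) → Vec (Tm ar m) (ar f) → Tm ar m

record Program : Set where
  field
    F     : ℕ
    arity : Fin F → ℕ
    body  : (f : Fin F) → Tm arity (arity f)
    main  : Tm arity 1

module Semantics (P : Program) (Act : Set) where
  open Program P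

  Env : ℕ → Set
  Env = Vec (Val Act)

  infix 4 _⊢_⇓_⟨_⟩ _⊢_⇓*_⟨_⟩

  -- ρ ⊢ t ⇓ v ⟨ k ⟩: in the environment ρ, t evaluates to v in time k.
  data _⊢_⇓_⟨_⟩ {m : ℕ} (ρ : Env m) : Tm arity m → Val Act → ℕ → Set

  data _⊢_⇓*_⟨_⟩ {m : ℕ} (ρ : Env m) : ∀ {l} → Vec (Tm arity m) l → Env l → ℕ → Set

  data _⊢_⇓_⟨_⟩ {m} ρ where
    ⇓var  : ∀ i → ρ ⊢ var i ⇓ lookup ρ i ⟨ 1 ⟩
    ⇓num  : ∀ j → ρ ⊢ num j ⇓ num j ⟨ 1 ⟩
    ⇓suc  : ∀ {t j k} → ρ ⊢ t ⇓ num j ⟨ k ⟩ → ρ ⊢ suc t ⇓ num (suc j) ⟨ 1 + k ⟩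
    ⇓cons : ∀ {t u v w k l} → ρ ⊢ t ⇓ v ⟨ k ⟩ → ρ ⊢ u ⇓ w ⟨ l ⟩ →
            ρ ⊢ cons t u ⇓ v ∷ᵥ w ⟨ 1 + k + l ⟩
    ⇓let  : ∀ {t u v w k l} → ρ ⊢ t ⇓ v ⟨ k ⟩ → (v ∷ ρ) ⊢ u ⇓ w ⟨ l ⟩ →
            ρ ⊢ let′ t u ⇓ w ⟨ 1 + k + l ⟩
    ⇓zero : ∀ {t z s a c w k l} → ρ ⊢ t ⇓ num 0 ⟨ k ⟩ → ρ ⊢ z ⇓ w ⟨ l ⟩ →
            ρ ⊢ match t z s a c ⇓ w ⟨ 1 + k + l ⟩
    ⇓pred : ∀ {t z s a c j w k l} → ρ ⊢ t ⇓ num (suc j) ⟨ k ⟩ → (num j ∷ ρ) ⊢ s ⇓ w ⟨ l ⟩ →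
            ρ ⊢ match t z s a c ⇓ w ⟨ 1 + k + l ⟩
    ⇓sym  : ∀ {t z s a c p w k l} → ρ ⊢ t ⇓ sym p ⟨ k ⟩ → (sym p ∷ ρ) ⊢ a ⇓ w ⟨ l ⟩ →
            ρ ⊢ match t z s a c ⇓ w ⟨ 1 + k + l ⟩
    ⇓pair : ∀ {t z s a c v₁ v₂ w k l} → ρ ⊢ t ⇓ v₁ ∷ᵥ v₂ ⟨ k ⟩ → (v₁ ∷ v₂ ∷ ρ) ⊢ c ⇓ w ⟨ l ⟩ →
            ρ ⊢ match t z s a c ⇓ w ⟨ 1 + k + l ⟩
    ⇓call : ∀ {f ts vs w k l} → ρ ⊢ ts ⇓* vs ⟨ k ⟩ → vs ⊢ body f ⇓ w ⟨ l ⟩ →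
            ρ ⊢ call f ts ⇓ w ⟨ 1 + k + l ⟩

  data _⊢_⇓*_⟨_⟩ {m} ρ where
    ⇓[]  : ρ ⊢ [] ⇓* [] ⟨ 0 ⟩
    _⇓∷_ : ∀ {l t v k j} {ts : Vec (Tm arity m) l} {vs} →
           ρ ⊢ t ⇓ v ⟨ k ⟩ → ρ ⊢ ts ⇓* vs ⟨ j ⟩ → ρ ⊢ (t ∷ ts) ⇓* (v ∷ vs) ⟨ k + j ⟩

_on_outputs_inTime_ : Program → ∀ {Act} → Val Act → Val Act → ℕ → Set
_on_outputs_inTime_ P {Act} input output k = (input ∷ []) ⊢ Program.main P ⇓ output ⟨ k ⟩
  where open Semantics P Act

list : ∀ {Act} → List (Val Act) → Val Act
list = foldr _∷ᵥ_ (num 0)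

encodeᴮ : ∀ {Act n} → BExp n → Val Act
encodeᴮ 0ᴮ       = list (num 0 ∷ [])
encodeᴮ 1ᴮ       = list (num 1 ∷ [])
encodeᴮ (prim t) = list (num 2 ∷ num (toℕ t) ∷ [])
encodeᴮ (b ·ᴮ c) = list (num 3 ∷ encodeᴮ b ∷ encodeᴮ c ∷ [])
encodeᴮ (b +ᴮ c) = list (num 4 ∷ encodeᴮ b ∷ encodeᴮ c ∷ [])
encodeᴮ (! b)    = list (num 5 ∷ encodeᴮ b ∷ [])

encode : ∀ {Act n} → Exp Act n → Val Act
encode (act p)      = list (num 0 ∷ sym p ∷ [])
encode (bool b)     = list (num 1 ∷ encodeᴮ b ∷ [])
encode (e · f)      = list (num 2 ∷ encode e ∷ encode f ∷ [])
encode (e +[ b ] f) = list (num 3 ∷ encodeᴮ b ∷ encode e ∷ encode f ∷ [])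
encode (e ^⟨ b ⟩)   = list (num 4 ∷ encodeᴮ b ∷ encode e ∷ [])

-- The transition table of an automaton with states numbered by φ: the
-- number of the start state, followed by one row per state, each listing
-- the outcomes for all atoms in the order of the enumeration atoms.
module _ {Act : Set} {n : ℕ} (A : Automaton Act n) where
  open Automaton A

  encodeAutomaton : ∀ {m} → State ↔ Fin m → Val Act
  encodeAutomaton {m} φ = number start ∷ᵥ list (tabulate row)
    where
    number : State → Val Act
    number x = num (toℕ (Inverse.to φ x))

    outcome : Out Act State → Val Act
    outcome reject     = num 0
    outcome accept     = num 1
    outcome (step p x) = sym p ∷ᵥ number x

    row : Fin m → Val Act
    row i = list (map (λ α → outcome (δ (Inverse.from φ i) α)) (atoms n))

{-# OPTIONS --safe #-}

-- Executing the recursive definition of the Thompson automaton literally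
-- rewrites the transitions of X_f at every enclosing product and loop, which
-- takes quadratic time.  Two passes avoid this.  The first, bottom-up, numbers
-- the states and computes every initial pseudostate ι_f once.  The second,
-- top-down, emits the row of each state once: since
-- (o ▷ g α) ▷ h α = o ▷ (g α ▷ h α), the uniform continuations imposed by
-- the enclosing products and loops compose to a single row, passed downwards.
-- For a fixed set of tests each node costs a constant, plus a multiple of
-- the size of the Boolean test attached to it.

module Submission where

open import Data.Bool.Base using (Bool; true; false; T; not; _∧_; _∨_; if_then_else_)
open import Data.Fin.Base as Fin using (Fin; zero; suc; toℕ; _↑ˡ_; _↑ʳ_)
open import Data.Fin.Patterns using (0F; 1F; 2F; 3F; 4F; 5F; 6F)
import Data.Fin.Properties as Finₚ
open import Data.List.Base using (List; []; _∷_; map; tabulate; _++_)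
import Data.List.Properties as Listₚ
open import Data.Nat.Base using (ℕ; zero; suc; NonZero; _+_; _*_; _≤_; _<ᵇ_; z≤n; s≤s)
import Data.Nat.Properties as ℕₚ
open import Data.Nat.Tactic.RingSolver using (solve-∀)
open import Data.Product.Base using (Σ-syntax; _×_; _,_)
open import Data.Sum.Base as Sum using (_⊎_; inj₁; inj₂)
open import Data.Sum.Function.Propositional using (_⊎-↔_)
open import Data.Unit.Base using (tt)
open import Data.Vec.Base using (Vec; []; _∷_; lookup)
open import Function.Base using (_∘_; const)
open import Function.Bundles using (_↔_; Inverse)
open import Function.Properties.Inverse using (↔-sym; ↔-trans)
open import Relation.Binary.PropositionalEquality as ≡ using (_≡_; refl; cong; cong₂; subst; module ≡-Reasoning)
open import Defs

-- The program

pattern nthᶠ      = 0F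
pattern testᶠ     = 1F
pattern selectᶠ   = 2F
pattern seqᶠ      = 3F
pattern fillᶠ     = 4F
pattern annotateᶠ = 5F
pattern rowsᶠ     = 6F

arity : Fin 7 → ℕ
arity = lookup (2 ∷ 2 ∷ 4 ∷ 2 ∷ 2 ∷ 3 ∷ 3 ∷ [])

-- For concrete `k` and `m` the implicit argument has unit type and is solved by η, so de Bruijn
-- indices can be written as numerals.
v : ∀ k {m} {_ : T (k <ᵇ m)} → Tm arity m
v k {m} {p} = var (Fin.fromℕ< (ℕₚ.<ᵇ⇒< k m p))

onPair : ∀ {m} → Tm arity m → Tm arity (2 + m) → Tm arity m
onPair t c = match t (num 0) (num 0) (num 0) c

onNum : ∀ {m} → Tm arity m → Tm arity m → Tm arity (1 + m) → Tm arity m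
onNum t z s = match t z s (num 0) (num 0)

-- Tags are recognised by counting down, so the branch for tag j sees its
-- variables shifted by the j predecessors of the tag.
body : (f : Fin 7) → Tm arity (arity f)

body nthᶠ = onNum (v 1)
  (onPair (v 0) (v 0))
  (onPair (v 1) (call nthᶠ (v 1 ∷ v 2 ∷ [])))

body testᶠ = onPair (v 0) (
  onNum (v 0) (num 0) (
  onNum (v 0) (num 1) (
  onNum (v 0) (onPair (v 3) (call nthᶠ (v 7 ∷ v 0 ∷ []))) (
  onNum (v 0) (onPair (v 4) (onNum (call testᶠ (v 0 ∷ v 8 ∷ []))
                (num 0)
                (onPair (v 2) (call testᶠ (v 0 ∷ v 11 ∷ []))))) (
  onNum (v 0) (onPair (v 5) (onNum (call testᶠ (v 0 ∷ v 9 ∷ []))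
                (onPair (v 1) (call testᶠ (v 0 ∷ v 11 ∷ [])))
                (num 1)))
              (onPair (v 6) (onNum (call testᶠ (v 0 ∷ v 10 ∷ [])) (num 1) (num 0))))))))

body selectᶠ = match (v 1) (num 0) (num 0) (num 0) (onPair (v 4) (onPair (v 7)
  (cons (onNum (call testᶠ (v 6 ∷ v 4 ∷ [])) (v 0) (v 3))
        (call selectᶠ (v 6 ∷ v 5 ∷ v 3 ∷ v 1 ∷ [])))))

body seqᶠ = match (v 0) (num 0) (num 0) (num 0) (onPair (v 3)
  -- The inner `match` is `▷` on encoded outcomes: 0 rejects and stays, 1 accepts and becomes the
  -- continuation, a pair is a step and stays.
  (cons (match (v 2) (num 0) (v 1) (num 0) (v 4))
        (call seqᶠ (v 3 ∷ v 1 ∷ []))))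

body fillᶠ = match (v 0) (num 0) (num 0) (num 0) (cons (v 3) (call fillᶠ (v 1 ∷ v 3 ∷ [])))

body annotateᶠ = onPair (v 0) (
  onNum (v 0)
    (onPair (v 1) (cons (suc (v 5)) (cons (call fillᶠ (v 6 ∷ cons (v 0) (v 5) ∷ [])) (num 1)))) (
  onNum (v 0)
    (onPair (v 2) (cons (v 6) (cons
      (call selectᶠ (v 0 ∷ v 7 ∷ call fillᶠ (v 7 ∷ num 1 ∷ []) ∷ call fillᶠ (v 7 ∷ num 0 ∷ []) ∷ []))
      (num 0)))) (
  onNum (v 0)
    (onPair (v 3) (onPair (v 1)
      (onPair (call annotateᶠ (v 2 ∷ v 9 ∷ v 10 ∷ [])) (onPair (v 1)
      (onPair (call annotateᶠ (v 4 ∷ v 2 ∷ v 14 ∷ [])) (onPair (v 1)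
        (cons (v 2) (cons (call seqᶠ (v 4 ∷ v 0 ∷ []))
          (cons (num 1) (cons (cons (num 0) (cons (v 0) (v 5))) (v 1))))))))))) (
  onNum (v 0)
    (onPair (v 4) (onPair (v 1) (onPair (v 1)
      (onPair (call annotateᶠ (v 2 ∷ v 12 ∷ v 13 ∷ [])) (onPair (v 1)
      (onPair (call annotateᶠ (v 4 ∷ v 2 ∷ v 17 ∷ [])) (onPair (v 1)
        (cons (v 2) (cons (call selectᶠ (v 12 ∷ v 21 ∷ v 4 ∷ v 0 ∷ []))
          (cons (num 1) (cons (v 5) (v 1))))))))))))
    (onPair (v 5) (onPair (v 1)
      (onPair (call annotateᶠ (v 0 ∷ v 11 ∷ v 12 ∷ [])) (onPair (v 1)
        -- The row of the loop is computed once and shared: it is the initial pseudostate and also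
        -- the continuation recorded in the tree. Sequencing the row of `f` with a row of 0s turns
        -- acceptance into rejection.
        (let′ (call selectᶠ (v 6 ∷ v 16
                 ∷ call seqᶠ (v 0 ∷ call fillᶠ (v 16 ∷ num 0 ∷ []) ∷ [])
                 ∷ call fillᶠ (v 16 ∷ num 1 ∷ []) ∷ []))
          (cons (v 3) (cons (v 0) (cons (num 0) (cons (v 0) (v 2))))))))))))))

-- Leaf 0 contributes no row and leaf 1 one row; a pair tagged 0 puts a row in front of the
-- continuation, a pair tagged 1 branches. The third argument is an accumulator: the right branch is
-- emitted first, so lists are never appended.
body rowsᶠ = match (v 0) (v 2) (cons (v 2) (v 3)) (num 0)
  (onNum (v 0)
    (onPair (v 1) (call rowsᶠ (v 1 ∷ call seqᶠ (v 0 ∷ v 5 ∷ []) ∷ v 6 ∷ [])))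
    (onPair (v 2) (call rowsᶠ (v 0 ∷ v 6 ∷ call rowsᶠ (v 1 ∷ v 6 ∷ v 7 ∷ []) ∷ []))))

bit : Bool → ℕ
bit false = 0
bit true  = 1

atomTm : ∀ {k m} → Vec Bool k → Tm arity m
atomTm []      = num 0
atomTm (b ∷ α) = cons (num (bit b)) (atomTm α)

atomsTm : ∀ {k m} → List (Vec Bool k) → Tm arity m
atomsTm []      = num 0
atomsTm (α ∷ L) = cons (atomTm α) (atomsTm L)

program : ℕ → Program
program n = record
  { F = 7 ; arity = arity ; body = body
  -- The tests are fixed before the program is, so the atoms may be written into its text.
  ; main = let′ (atomsTm (atoms n))
      -- State 0 is reserved for the start state, hence counting starts at 1. The outermost
      -- continuation is the row of 1s, since `accept` is a right unit of `▷`.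
      (onPair (call annotateᶠ (v 1 ∷ num 1 ∷ v 0 ∷ [])) (onPair (v 1)
        (cons (num 0) (cons (v 0)
          (call rowsᶠ (v 1 ∷ call fillᶠ (v 4 ∷ num 1 ∷ []) ∷ num 0 ∷ []))))))
  }

-- Time functions

-- Running times are written in credit-passing style: a time function maps
-- the credit that has to be left over to the credit needed at the start.
-- The literals count the evaluation steps between two calls.

nthTime : ∀ {k} → Fin k → ℕ → ℕ
nthTime zero    k = 5 + k
nthTime (suc i) k = 7 + nthTime i k

testTime : ∀ {n} → BExp n → ℕ → ℕ
testTime 0ᴮ       k = 5 + k
testTime 1ᴮ       k = 7 + k
testTime (prim t) k = 13 + nthTime t k
testTime (b ·ᴮ c) k = 16 + testTime b (5 + testTime c k)
testTime (b +ᴮ c) k = 18 + testTime b (5 + testTime c k)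
testTime (! b)    k = 18 + testTime b (1 + k)

zipTime : ∀ {A : Set} → ℕ → List A → ℕ → ℕ
zipTime d []      k = 3 + k
zipTime d (x ∷ L) k = d + zipTime d L k

selectTime : ∀ {n} → BExp n → List (At n) → ℕ → ℕ
selectTime b []      k = 3 + k
selectTime b (α ∷ L) k = 11 + testTime b (6 + selectTime b L k)

atomTime : ∀ {k} → Vec Bool k → ℕ → ℕ
atomTime []      k = 1 + k
atomTime (_ ∷ α) k = 2 + atomTime α k

atomsTime : ∀ {k} → List (Vec Bool k) → ℕ → ℕ
atomsTime []      k = 1 + k
atomsTime (α ∷ L) k = 1 + atomTime α (atomsTime L k)

module _ {n : ℕ} where

  fillTime seqTime : ℕ → ℕ
  fillTime = zipTime 7 (atoms n)
  seqTime  = zipTime 11 (atoms n)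

  annotateTime : ∀ {Act} → Exp Act n → ℕ → ℕ
  annotateTime (act p)      k = 15 + fillTime (1 + k)
  annotateTime (bool b)     k = 17 + fillTime (3 + fillTime (selectTime b (atoms n) (1 + k)))
  annotateTime (f · g)      k =
    17 + annotateTime f (7 + annotateTime g (8 + seqTime (9 + k)))
  annotateTime (f +[ b ] g) k =
    21 + annotateTime f (7 + annotateTime g (10 + selectTime b (atoms n) (5 + k)))
  annotateTime (f ^⟨ b ⟩)   k =
    19 + annotateTime f (11 + fillTime (seqTime (3 + fillTime (selectTime b (atoms n) (9 + k)))))

  rowsTime : ∀ {Act} → Exp Act n → ℕ → ℕ
  rowsTime (act p)      k = 5 + k
  rowsTime (bool b)     k = 3 + k
  rowsTime (f · g)      k = 13 + rowsTime g (11 + seqTime (1 + rowsTime f k))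
  rowsTime (f +[ b ] g) k = 13 + rowsTime g (rowsTime f k)
  rowsTime (f ^⟨ b ⟩)   k = 11 + seqTime (1 + rowsTime f k)

  mainTime : ∀ {Act} → Exp Act n → ℕ → ℕ
  mainTime e k =
    1 + atomsTime (atoms n) (5 + annotateTime e (11 + fillTime (1 + rowsTime e k)))

-- Numbered states and the intended results of the two passes

encodeOut : ∀ {Act} → Out Act ℕ → Val Act
encodeOut reject     = num 0
encodeOut accept     = num 1
encodeOut (step p i) = sym p ∷ᵥ num i

module _ {Act : Set} {n : ℕ} where

  -- The first number still free once the states of the expression are numbered from `i`. The
  -- machine can count but not add, so the counter is threaded through the recursion.
  next : Exp Act n → ℕ → ℕ
  next (act p)      i = suc i
  next (bool b)     i = i
  next (f · g)      i = next g (next f i)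
  next (f +[ b ] g) i = next g (next f i)
  next (f ^⟨ b ⟩)   i = next f i

  number : ∀ (e : Exp Act n) → ℕ → X⟨ e ⟩ → ℕ
  number (act p)      i _        = i
  number (f · g)      i (inj₁ x) = number f i x
  number (f · g)      i (inj₂ y) = number g (next f i) y
  number (f +[ b ] g) i (inj₁ x) = number f i x
  number (f +[ b ] g) i (inj₂ y) = number g (next f i) y
  number (f ^⟨ b ⟩)   i x        = number f i x

  initial : Exp Act n → ℕ → G Act n ℕ
  initial (act p)      i α = step p i
  initial (bool b)     i α = if eval α b then accept else reject
  initial (f · g)      i α = initial f i α ▷ initial g (next f i) α
  initial (f +[ b ] g) i α = if eval α b then initial f i α else initial g (next f i) α
  initial (f ^⟨ b ⟩)   i α = if eval α b then initial f i α ▷ reject else accept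

  outcomes : List (At n) → G Act n ℕ → Val Act
  outcomes L g = list (map (encodeOut ∘ g) L)

  encodeRow : G Act n ℕ → Val Act
  encodeRow = outcomes (atoms n)

  -- The rows of δ⟨ e ⟩ are obtained by handing a continuation down the
  -- expression; the tree records the continuations of products and loops.
  tree : Exp Act n → ℕ → Val Act
  tree (act p)        i = num 1
  tree (bool b)       i = num 0
  tree (f · g)        i =
    num 1 ∷ᵥ (num 0 ∷ᵥ encodeRow (initial g (next f i)) ∷ᵥ tree f i) ∷ᵥ tree g (next f i)
  tree (f +[ b ] g)   i = num 1 ∷ᵥ tree f i ∷ᵥ tree g (next f i)
  tree e@(f ^⟨ b ⟩)   i = num 0 ∷ᵥ encodeRow (initial e i) ∷ᵥ tree f i

  -- `h` is the continuation composed from all enclosing products and loops; `vs` holds the rows of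
  -- the states that come later.
  rows : Exp Act n → ℕ → G Act n ℕ → List (Val Act) → List (Val Act)
  rows (act p)        i h vs = encodeRow h ∷ vs
  rows (bool b)       i h vs = vs
  rows (f · g)        i h vs = rows f i (λ α → initial g (next f i) α ▷ h α) (rows g (next f i) h vs)
  rows (f +[ b ] g)   i h vs = rows f i h (rows g (next f i) h vs)
  rows e@(f ^⟨ b ⟩)   i h vs = rows f i (λ α → initial e i α ▷ h α) vs

encodeAtom : ∀ {Act k} → Vec Bool k → Val Act
encodeAtom []      = num 0
encodeAtom (b ∷ α) = num (bit b) ∷ᵥ encodeAtom α

encodeAtoms : ∀ {Act k} → List (Vec Bool k) → Val Act
encodeAtoms L = list (map encodeAtom L)

-- Evaluation of the program within its credit

module Runs (n : ℕ) (Act : Set) where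
  open Semantics (program n) Act

  infix 4 _⊢_⇓_⟨_▸_⟩ _⊢_⇓*_⟨_▸_⟩
  infixr 5 _↓∷_

  -- Starting with credit a, the evaluation leaves at least credit b.
  record _⊢_⇓_⟨_▸_⟩ {m} (ρ : Env m) (t : Tm arity m) (w : Val Act) (a b : ℕ) : Set where
    constructor run
    field
      {time}     : ℕ
      derivation : ρ ⊢ t ⇓ w ⟨ time ⟩
      within     : time + b ≤ a

  record _⊢_⇓*_⟨_▸_⟩ {m l} (ρ : Env m) (ts : Vec (Tm arity m) l) (ws : Env l) (a b : ℕ) : Set where
    constructor run
    field
      {time}     : ℕ
      derivation : ρ ⊢ ts ⇓* ws ⟨ time ⟩
      within     : time + b ≤ a

  private variable
    m l a b c : ℕ
    ρ         : Env m

  together : ∀ {k l} → k + b ≤ a → l + c ≤ b → k + l + c ≤ a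
  together {b} {a} {c} {k} {l} p q = begin
    k + l + c   ≡⟨ ℕₚ.+-assoc k l c ⟩
    k + (l + c) ≤⟨ ℕₚ.+-monoʳ-≤ k q ⟩
    k + b       ≤⟨ p ⟩
    a           ∎
    where open ℕₚ.≤-Reasoning

  ↓var : ∀ {i} → ρ ⊢ var i ⇓ lookup ρ i ⟨ suc a ▸ a ⟩
  ↓var = run (⇓var _) ℕₚ.≤-refl

  ↓num : ∀ {j} → ρ ⊢ num j ⇓ num j ⟨ suc a ▸ a ⟩
  ↓num = run (⇓num _) ℕₚ.≤-refl

  ↓suc : ∀ {t j} → ρ ⊢ t ⇓ num j ⟨ a ▸ b ⟩ → ρ ⊢ suc t ⇓ num (suc j) ⟨ suc a ▸ b ⟩
  ↓suc (run d p) = run (⇓suc d) (s≤s p)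

  ↓cons : ∀ {t u w x} → ρ ⊢ t ⇓ w ⟨ a ▸ b ⟩ → ρ ⊢ u ⇓ x ⟨ b ▸ c ⟩ →
          ρ ⊢ cons t u ⇓ w ∷ᵥ x ⟨ suc a ▸ c ⟩
  ↓cons (run d p) (run e q) = run (⇓cons d e) (s≤s (together p q))

  ↓let : ∀ {t u w x} → ρ ⊢ t ⇓ w ⟨ a ▸ b ⟩ → (w ∷ ρ) ⊢ u ⇓ x ⟨ b ▸ c ⟩ →
         ρ ⊢ let′ t u ⇓ x ⟨ suc a ▸ c ⟩
  ↓let (run d p) (run e q) = run (⇓let d e) (s≤s (together p q))

  ↓zero : ∀ {t z s y r w} → ρ ⊢ t ⇓ num 0 ⟨ a ▸ b ⟩ → ρ ⊢ z ⇓ w ⟨ b ▸ c ⟩ →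
          ρ ⊢ match t z s y r ⇓ w ⟨ suc a ▸ c ⟩
  ↓zero (run d p) (run e q) = run (⇓zero d e) (s≤s (together p q))

  ↓pred : ∀ {t z s y r j w} → ρ ⊢ t ⇓ num (suc j) ⟨ a ▸ b ⟩ → (num j ∷ ρ) ⊢ s ⇓ w ⟨ b ▸ c ⟩ →
          ρ ⊢ match t z s y r ⇓ w ⟨ suc a ▸ c ⟩
  ↓pred (run d p) (run e q) = run (⇓pred d e) (s≤s (together p q))

  ↓pair : ∀ {t z s y r w₁ w₂ w} → ρ ⊢ t ⇓ w₁ ∷ᵥ w₂ ⟨ a ▸ b ⟩ → (w₁ ∷ w₂ ∷ ρ) ⊢ r ⇓ w ⟨ b ▸ c ⟩ →
          ρ ⊢ match t z s y r ⇓ w ⟨ suc a ▸ c ⟩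
  ↓pair (run d p) (run e q) = run (⇓pair d e) (s≤s (together p q))

  ↓call : ∀ {f ts ws w} → ρ ⊢ ts ⇓* ws ⟨ a ▸ b ⟩ → ws ⊢ body f ⇓ w ⟨ b ▸ c ⟩ →
          ρ ⊢ call f ts ⇓ w ⟨ suc a ▸ c ⟩
  ↓call (run d p) (run e q) = run (⇓call d e) (s≤s (together p q))

  ↓[] : ρ ⊢ [] ⇓* [] ⟨ a ▸ a ⟩
  ↓[] = run ⇓[] ℕₚ.≤-refl

  _↓∷_ : ∀ {t w} {ts : Vec (Tm arity m) l} {ws} →
         ρ ⊢ t ⇓ w ⟨ a ▸ b ⟩ → ρ ⊢ ts ⇓* ws ⟨ b ▸ c ⟩ → ρ ⊢ t ∷ ts ⇓* w ∷ ws ⟨ a ▸ c ⟩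
  run d p ↓∷ run e q = run (d ⇓∷ e) (together p q)

  -- Credit may be thrown away, so that a cheap branch of a conditional ends with the same credit as
  -- an expensive one.
  leave : ∀ {t w} → c ≤ b → ρ ⊢ t ⇓ w ⟨ a ▸ b ⟩ → ρ ⊢ t ⇓ w ⟨ a ▸ c ⟩
  leave c≤b (run {k} d p) = run d (ℕₚ.≤-trans (ℕₚ.+-monoʳ-≤ k c≤b) p)

  left≤start : ∀ {t w} → ρ ⊢ t ⇓ w ⟨ a ▸ b ⟩ → b ≤ a
  left≤start (run {k} _ p) = ℕₚ.≤-trans (ℕₚ.m≤n+m _ k) p

  -- The result is a function `w` of the truth value, so a caller can treat both branches at once
  -- without splitting on an evaluated test.
  ↓if : ∀ {t z s y r} (w : Bool → Val Act) x → ρ ⊢ t ⇓ num (bit x) ⟨ a ▸ b ⟩ →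
        ρ ⊢ z ⇓ w false ⟨ b ▸ c ⟩ → (num 0 ∷ ρ) ⊢ s ⇓ w true ⟨ b ▸ c ⟩ →
        ρ ⊢ match t z s y r ⇓ w x ⟨ suc a ▸ c ⟩
  ↓if w false d e f = ↓zero d e
  ↓if w true  d e f = ↓pred d f

  nth-run : ∀ {k} (α : Vec Bool k) i → (encodeAtom α ∷ num (toℕ i) ∷ []) ⊢ body nthᶠ
              ⇓ num (bit (lookup α i)) ⟨ nthTime i a ▸ a ⟩
  nth-run (b ∷ α) zero    = ↓zero ↓var (↓pair ↓var ↓var)
  nth-run (b ∷ α) (suc i) = ↓pred ↓var (↓pair ↓var (↓call (↓var ↓∷ ↓var ↓∷ ↓[]) (nth-run α i)))

  test-run : ∀ (α : At n) b → (encodeᴮ b ∷ encodeAtom α ∷ []) ⊢ body testᶠ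
               ⇓ num (bit (eval α b)) ⟨ testTime b a ▸ a ⟩
  test-run α 0ᴮ       = ↓pair ↓var (↓zero ↓var ↓num)
  test-run α 1ᴮ       = ↓pair ↓var (↓pred ↓var (↓zero ↓var ↓num))
  test-run α (prim t) = ↓pair ↓var (↓pred ↓var (↓pred ↓var (↓zero ↓var (↓pair ↓var
    (↓call (↓var ↓∷ ↓var ↓∷ ↓[]) (nth-run α t))))))
  test-run {a} α (b ·ᴮ c) = ↓pair ↓var (↓pred ↓var (↓pred ↓var (↓pred ↓var (↓zero ↓var (↓pair ↓var
    (↓if (λ x → num (bit (x ∧ eval α c))) (eval α b)
      (↓call (↓var ↓∷ ↓var ↓∷ ↓[]) (test-run α b))
      -- Short circuit: `↓num` uses one credit, and the other 4 are discarded with the whole credit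
      -- for `c`. That this leaves at least `a` is read off the run of `c` itself.
      (leave (ℕₚ.≤-trans (left≤start (test-run α c)) (ℕₚ.m≤n+m _ 4)) ↓num)
      (↓pair ↓var (↓call (↓var ↓∷ ↓var ↓∷ ↓[]) (test-run α c)))))))))
  test-run α (b +ᴮ c) =
    ↓pair ↓var (↓pred ↓var (↓pred ↓var (↓pred ↓var (↓pred ↓var (↓zero ↓var (↓pair ↓var
    (↓if (λ x → num (bit (x ∨ eval α c))) (eval α b)
      (↓call (↓var ↓∷ ↓var ↓∷ ↓[]) (test-run α b))
      (↓pair ↓var (↓call (↓var ↓∷ ↓var ↓∷ ↓[]) (test-run α c)))
      (leave (ℕₚ.≤-trans (left≤start (test-run α c)) (ℕₚ.m≤n+m _ 4)) ↓num))))))))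
  test-run α (! b)    =
    ↓pair ↓var (↓pred ↓var (↓pred ↓var (↓pred ↓var (↓pred ↓var (↓pred ↓var (↓pair ↓var
    (↓if (λ x → num (bit (not x))) (eval α b)
      (↓call (↓var ↓∷ ↓var ↓∷ ↓[]) (test-run α b)) ↓num ↓num)))))))

  select-run : ∀ b L (g h : G Act n ℕ) →
    (encodeᴮ b ∷ encodeAtoms L ∷ outcomes L g ∷ outcomes L h ∷ []) ⊢ body selectᶠ
      ⇓ outcomes L (λ α → if eval α b then g α else h α) ⟨ selectTime b L a ▸ a ⟩
  select-run b []      g h = ↓zero ↓var ↓num
  select-run b (α ∷ L) g h = ↓pair ↓var (↓pair ↓var (↓pair ↓var (↓cons
    (↓if (λ x → encodeOut (if x then g α else h α)) (eval α b)
      (↓call (↓var ↓∷ ↓var ↓∷ ↓[]) (test-run α b)) ↓var ↓var)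
    (↓call (↓var ↓∷ ↓var ↓∷ ↓var ↓∷ ↓var ↓∷ ↓[]) (select-run b L g h)))))

  seq-run : ∀ L (g h : G Act n ℕ) →
    (outcomes L g ∷ outcomes L h ∷ []) ⊢ body seqᶠ
      ⇓ outcomes L (λ α → g α ▷ h α) ⟨ zipTime 11 L a ▸ a ⟩
  seq-run []      g h = ↓zero ↓var ↓num
  seq-run (α ∷ L) g h with g α
  ... | reject   = ↓pair ↓var (↓pair ↓var (↓cons (↓zero ↓var ↓num)
                     (↓call (↓var ↓∷ ↓var ↓∷ ↓[]) (seq-run L g h))))
  ... | accept   = ↓pair ↓var (↓pair ↓var (↓cons (↓pred ↓var ↓var)
                     (↓call (↓var ↓∷ ↓var ↓∷ ↓[]) (seq-run L g h))))
  ... | step p i = ↓pair ↓var (↓pair ↓var (↓cons (↓pair ↓var ↓var)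
                     (↓call (↓var ↓∷ ↓var ↓∷ ↓[]) (seq-run L g h))))

  fill-run : ∀ (L : List (At n)) (o : Out Act ℕ) → (encodeAtoms L ∷ encodeOut o ∷ []) ⊢ body fillᶠ
               ⇓ outcomes L (const o) ⟨ zipTime 7 L a ▸ a ⟩
  fill-run []      o = ↓zero ↓var ↓num
  fill-run (α ∷ L) o = ↓pair ↓var (↓cons ↓var (↓call (↓var ↓∷ ↓var ↓∷ ↓[]) (fill-run L o)))

  -- The derivation follows the function body. Every evaluation rule takes one `suc` off the credit,
  -- so unification finds the intermediate credits and thereby checks the literals of
  -- `annotateTime`.
  annotate-run : ∀ (e : Exp Act n) i →
    (encode e ∷ num i ∷ encodeAtoms (atoms n) ∷ []) ⊢ body annotateᶠ
      ⇓ num (next e i) ∷ᵥ encodeRow (initial e i) ∷ᵥ tree e i ⟨ annotateTime e a ▸ a ⟩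
  annotate-run (act p) i = ↓pair ↓var (↓zero ↓var (↓pair ↓var (↓cons (↓suc ↓var) (↓cons
    (↓call (↓var ↓∷ ↓cons ↓var ↓var ↓∷ ↓[]) (fill-run (atoms n) (step p i))) ↓num))))
  annotate-run (bool b) i = ↓pair ↓var (↓pred ↓var (↓zero ↓var (↓pair ↓var (↓cons ↓var (↓cons
    (↓call (↓var ↓∷ ↓var ↓∷ ↓call (↓var ↓∷ ↓num ↓∷ ↓[]) (fill-run (atoms n) accept)
                 ↓∷ ↓call (↓var ↓∷ ↓num ↓∷ ↓[]) (fill-run (atoms n) reject) ↓∷ ↓[])
      (select-run b (atoms n) (const accept) (const reject)))
    ↓num)))))
  annotate-run (f · g) i = ↓pair ↓var (↓pred ↓var (↓pred ↓var (↓zero ↓var (↓pair ↓var (↓pair ↓var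
    (↓pair (↓call (↓var ↓∷ ↓var ↓∷ ↓var ↓∷ ↓[]) (annotate-run f i)) (↓pair ↓var
    (↓pair (↓call (↓var ↓∷ ↓var ↓∷ ↓var ↓∷ ↓[]) (annotate-run g (next f i))) (↓pair ↓var
    (↓cons ↓var (↓cons
      (↓call (↓var ↓∷ ↓var ↓∷ ↓[]) (seq-run (atoms n) (initial f i) (initial g (next f i))))
      (↓cons ↓num (↓cons (↓cons ↓num (↓cons ↓var ↓var)) ↓var)))))))))))))
  annotate-run (f +[ b ] g) i =
    ↓pair ↓var (↓pred ↓var (↓pred ↓var (↓pred ↓var (↓zero ↓var (↓pair ↓var (↓pair ↓var (↓pair ↓var
    (↓pair (↓call (↓var ↓∷ ↓var ↓∷ ↓var ↓∷ ↓[]) (annotate-run f i)) (↓pair ↓var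
    (↓pair (↓call (↓var ↓∷ ↓var ↓∷ ↓var ↓∷ ↓[]) (annotate-run g (next f i))) (↓pair ↓var
    (↓cons ↓var (↓cons
      (↓call (↓var ↓∷ ↓var ↓∷ ↓var ↓∷ ↓var ↓∷ ↓[])
        (select-run b (atoms n) (initial f i) (initial g (next f i))))
      (↓cons ↓num (↓cons ↓var ↓var)))))))))))))))
  annotate-run (f ^⟨ b ⟩) i =
    ↓pair ↓var (↓pred ↓var (↓pred ↓var (↓pred ↓var (↓pred ↓var (↓pair ↓var (↓pair ↓var
    (↓pair (↓call (↓var ↓∷ ↓var ↓∷ ↓var ↓∷ ↓[]) (annotate-run f i)) (↓pair ↓var
    (↓let
      (↓call (↓var ↓∷ ↓var
              ↓∷ ↓call (↓var ↓∷ ↓call (↓var ↓∷ ↓num ↓∷ ↓[]) (fill-run (atoms n) reject) ↓∷ ↓[])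
                   (seq-run (atoms n) (initial f i) (const reject))
              ↓∷ ↓call (↓var ↓∷ ↓num ↓∷ ↓[]) (fill-run (atoms n) accept) ↓∷ ↓[])
        (select-run b (atoms n) (λ α → initial f i α ▷ reject) (const accept)))
      (↓cons ↓var (↓cons ↓var (↓cons ↓num (↓cons ↓var ↓var)))))))))))))

  rows-run : ∀ (e : Exp Act n) i h vs →
    (tree e i ∷ encodeRow h ∷ list vs ∷ []) ⊢ body rowsᶠ
      ⇓ list (rows e i h vs) ⟨ rowsTime e a ▸ a ⟩
  rows-run (act p)      i h vs = ↓pred ↓var (↓cons ↓var ↓var)
  rows-run (bool b)     i h vs = ↓zero ↓var ↓var
  rows-run (f · g)      i h vs = ↓pair ↓var (↓pred ↓var (↓pair ↓var
    (↓call (↓var ↓∷ ↓var ↓∷ ↓call (↓var ↓∷ ↓var ↓∷ ↓var ↓∷ ↓[]) (rows-run g (next f i) h vs) ↓∷ ↓[])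
      (↓pair ↓var (↓zero ↓var (↓pair ↓var
        (↓call (↓var ↓∷ ↓call (↓var ↓∷ ↓var ↓∷ ↓[]) (seq-run (atoms n) (initial g (next f i)) h)
                     ↓∷ ↓var ↓∷ ↓[])
          (rows-run f i _ (rows g (next f i) h vs)))))))))
  rows-run (f +[ b ] g) i h vs = ↓pair ↓var (↓pred ↓var (↓pair ↓var
    (↓call (↓var ↓∷ ↓var ↓∷ ↓call (↓var ↓∷ ↓var ↓∷ ↓var ↓∷ ↓[]) (rows-run g (next f i) h vs) ↓∷ ↓[])
      (rows-run f i h (rows g (next f i) h vs)))))
  rows-run e@(f ^⟨ b ⟩) i h vs = ↓pair ↓var (↓zero ↓var (↓pair ↓var
    (↓call (↓var ↓∷ ↓call (↓var ↓∷ ↓var ↓∷ ↓[]) (seq-run (atoms n) (initial e i) h) ↓∷ ↓var ↓∷ ↓[])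
      (rows-run f i _ vs))))

  atom-run : ∀ {k} (α : Vec Bool k) → ρ ⊢ atomTm α ⇓ encodeAtom α ⟨ atomTime α a ▸ a ⟩
  atom-run []      = ↓num
  atom-run (b ∷ α) = ↓cons ↓num (atom-run α)

  atoms-run : ∀ {k} (L : List (Vec Bool k)) → ρ ⊢ atomsTm L ⇓ encodeAtoms L ⟨ atomsTime L a ▸ a ⟩
  atoms-run []      = ↓num
  atoms-run (α ∷ L) = ↓cons (atom-run α) (atoms-run L)

  main-run : ∀ (e : Exp Act n) → (encode e ∷ []) ⊢ Program.main (program n)
    ⇓ num 0 ∷ᵥ list (encodeRow (initial e 1) ∷ rows e 1 (const accept) [])
    ⟨ mainTime e a ▸ a ⟩
  main-run e = ↓let (atoms-run (atoms n))
    (↓pair (↓call (↓var ↓∷ ↓num ↓∷ ↓var ↓∷ ↓[]) (annotate-run e 1)) (↓pair ↓var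
      (↓cons ↓num (↓cons ↓var
        (↓call (↓var ↓∷ ↓call (↓var ↓∷ ↓num ↓∷ ↓[]) (fill-run (atoms n) accept) ↓∷ ↓num ↓∷ ↓[])
          (rows-run e 1 (const accept) []))))))

-- Agreement of the output with the Thompson automaton

module _ {Act : Set} where

  mapOut-∘ : ∀ {X Y Z : Set} (f : Y → Z) (g : X → Y) (o : Out Act X) →
             mapOut f (mapOut g o) ≡ mapOut (f ∘ g) o
  mapOut-∘ f g reject     = refl
  mapOut-∘ f g accept     = refl
  mapOut-∘ f g (step p x) = refl

  mapOut-cong : ∀ {X Y : Set} {f g : X → Y} → (∀ x → f x ≡ g x) → (o : Out Act X) →
                mapOut f o ≡ mapOut g o
  mapOut-cong p reject     = refl
  mapOut-cong p accept     = refl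
  mapOut-cong p (step q x) = cong (step q) (p x)

  mapOut-▷ : ∀ {X Y : Set} (f : X → Y) (o o′ : Out Act X) →
             mapOut f (o ▷ o′) ≡ mapOut f o ▷ mapOut f o′
  mapOut-▷ f reject     o′ = refl
  mapOut-▷ f accept     o′ = refl
  mapOut-▷ f (step p x) o′ = refl

  ▷-assoc : ∀ {X : Set} (o o′ o″ : Out Act X) → (o ▷ o′) ▷ o″ ≡ o ▷ (o′ ▷ o″)
  ▷-assoc reject     o′ o″ = refl
  ▷-assoc accept     o′ o″ = refl
  ▷-assoc (step p x) o′ o″ = refl

  ▷-identityʳ : ∀ {X : Set} (o : Out Act X) → o ▷ accept ≡ o
  ▷-identityʳ reject     = refl
  ▷-identityʳ accept     = refl
  ▷-identityʳ (step p x) = refl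

tabulate-+ : ∀ {A : Set} m {n} (f : Fin (m + n) → A) →
             tabulate f ≡ tabulate (f ∘ (_↑ˡ n)) ++ tabulate (f ∘ (m ↑ʳ_))
tabulate-+ zero    f = refl
tabulate-+ (suc m) f = cong (f zero ∷_) (tabulate-+ m (f ∘ suc))

-- Joins the rows of two operands into the rows of their coproduct, in front of the accumulator
-- `zs`.
map-⊎ : ∀ {A B C : Set} {f : A → C} {g : B → C} (h : A ⊎ B → C) xs ys zs →
        (∀ x → f x ≡ h (inj₁ x)) → (∀ y → g y ≡ h (inj₂ y)) →
        map f xs ++ (map g ys ++ zs) ≡ map h (map inj₁ xs ++ map inj₂ ys) ++ zs
map-⊎ {f = f} {g} h xs ys zs p q = begin
  map f xs ++ (map g ys ++ zs)
    ≡⟨ cong₂ (λ us vs → us ++ (vs ++ zs)) (Listₚ.map-cong p xs) (Listₚ.map-cong q ys) ⟩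
  map (h ∘ inj₁) xs ++ (map (h ∘ inj₂) ys ++ zs)
    ≡⟨ Listₚ.++-assoc (map (h ∘ inj₁) xs) _ zs ⟨
  (map (h ∘ inj₁) xs ++ map (h ∘ inj₂) ys) ++ zs
    ≡⟨ cong (_++ zs) (cong₂ _++_ (Listₚ.map-∘ xs) (Listₚ.map-∘ ys)) ⟩
  (map h (map inj₁ xs) ++ map h (map inj₂ ys)) ++ zs
    ≡⟨ cong (_++ zs) (Listₚ.map-++ h (map inj₁ xs) (map inj₂ ys)) ⟨
  map h (map inj₁ xs ++ map inj₂ ys) ++ zs ∎
  where open ≡-Reasoning

module _ {Act : Set} {n : ℕ} where

  encodeRow-cong : ∀ {g h : G Act n ℕ} → (∀ α → g α ≡ h α) → encodeRow g ≡ encodeRow h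
  encodeRow-cong p = cong list (Listₚ.map-cong (λ α → cong encodeOut (p α)) (atoms n))

  -- `mapOut` commutes with `▷`, and `does (α ≤? b)` computes to `eval α b`, so one case split
  -- resolves the conditional on both sides.
  initial-correct : ∀ (e : Exp Act n) i α → initial e i α ≡ mapOut (number e i) (ι⟨ e ⟩ α)
  initial-correct (act p)  i α = refl
  initial-correct (bool b) i α with eval α b
  ... | true  = refl
  ... | false = refl
  initial-correct (f · g) i α = begin
    initial f i α ▷ initial g (next f i) α
      ≡⟨ cong₂ _▷_ (initial-correct f i α) (initial-correct g (next f i) α) ⟩
    mapOut (number f i) (ι⟨ f ⟩ α) ▷ mapOut (number g (next f i)) (ι⟨ g ⟩ α)
      ≡⟨ cong₂ _▷_ (mapOut-∘ N inj₁ (ι⟨ f ⟩ α)) (mapOut-∘ N inj₂ (ι⟨ g ⟩ α)) ⟨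
    mapOut N (mapOut inj₁ (ι⟨ f ⟩ α)) ▷ mapOut N (mapOut inj₂ (ι⟨ g ⟩ α))
      ≡⟨ mapOut-▷ N (mapOut inj₁ (ι⟨ f ⟩ α)) _ ⟨
    mapOut N (ι⟨ f · g ⟩ α) ∎
    where
    open ≡-Reasoning
    N = number (f · g) i
  initial-correct (f +[ b ] g) i α with eval α b
  ... | true  = ≡.trans (initial-correct f i α) (≡.sym (mapOut-∘ (number (f +[ b ] g) i) inj₁ (ι⟨ f ⟩ α)))
  ... | false = ≡.trans (initial-correct g (next f i) α)
                  (≡.sym (mapOut-∘ (number (f +[ b ] g) i) inj₂ (ι⟨ g ⟩ α)))
  initial-correct (f ^⟨ b ⟩) i α with eval α b
  ... | true  = ≡.trans (cong (_▷ reject) (initial-correct f i α))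
                  (≡.sym (mapOut-▷ (number f i) (ι⟨ f ⟩ α) reject))
  ... | false = refl

  -- Mediates between `rows`, which recurses on the expression, and the transition table, which is
  -- tabulated over `Fin`.
  states : (e : Exp Act n) → List X⟨ e ⟩
  states (act p)      = tt ∷ []
  states (bool b)     = []
  states (f · g)      = map inj₁ (states f) ++ map inj₂ (states g)
  states (f +[ b ] g) = map inj₁ (states f) ++ map inj₂ (states g)
  states (f ^⟨ b ⟩)   = states f

  continued : (e : Exp Act n) → ℕ → G Act n ℕ → X⟨ e ⟩ → G Act n ℕ
  continued e i h x α = mapOut (number e i) (δ⟨ e ⟩ x α) ▷ h α

  -- Uniform continuations compose: δ [ Y , g ] followed by h continues
  -- δ by g ▷ h on Y.
  rows-correct : ∀ (e : Exp Act n) i h vs →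
    rows e i h vs ≡ map (encodeRow ∘ continued e i h) (states e) ++ vs
  rows-correct (act p)  i h vs = refl
  rows-correct (bool b) i h vs = refl
  rows-correct e@(f · g) i h vs = ≡.trans (rows-correct f i _ _)
    (≡.trans (cong (map (encodeRow ∘ continued f i h′) (states f) ++_) (rows-correct g j h vs))
      (map-⊎ (encodeRow ∘ continued e i h) (states f) (states g) vs
        (λ x → encodeRow-cong (λ α → begin
          mapOut (number f i) (δ⟨ f ⟩ x α) ▷ (initial g j α ▷ h α)
            ≡⟨ ▷-assoc (mapOut (number f i) (δ⟨ f ⟩ x α)) (initial g j α) (h α) ⟨
          (mapOut (number f i) (δ⟨ f ⟩ x α) ▷ initial g j α) ▷ h α
            ≡⟨ cong₂ (λ o o′ → (o ▷ o′) ▷ h α) (≡.sym (mapOut-∘ N inj₁ (δ⟨ f ⟩ x α)))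
                 (≡.trans (initial-correct g j α) (≡.sym (mapOut-∘ N inj₂ (ι⟨ g ⟩ α)))) ⟩
          (mapOut N (mapOut inj₁ (δ⟨ f ⟩ x α)) ▷ mapOut N (mapOut inj₂ (ι⟨ g ⟩ α))) ▷ h α
            ≡⟨ cong (_▷ h α) (mapOut-▷ N (mapOut inj₁ (δ⟨ f ⟩ x α)) _) ⟨
          mapOut N (δ⟨ e ⟩ (inj₁ x) α) ▷ h α ∎))
        (λ y → encodeRow-cong (λ α → cong (_▷ h α) (≡.sym (mapOut-∘ N inj₂ (δ⟨ g ⟩ y α)))))))
    where
    open ≡-Reasoning
    j = next f i
    N = number e i
    h′ = λ α → initial g j α ▷ h α
  rows-correct e@(f +[ b ] g) i h vs = ≡.trans (rows-correct f i h _)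
    (≡.trans (cong (map (encodeRow ∘ continued f i h) (states f) ++_) (rows-correct g (next f i) h vs))
      (map-⊎ (encodeRow ∘ continued e i h) (states f) (states g) vs
        (λ x → encodeRow-cong (λ α → cong (_▷ h α) (≡.sym (mapOut-∘ (number e i) inj₁ (δ⟨ f ⟩ x α)))))
        (λ y → encodeRow-cong (λ α → cong (_▷ h α) (≡.sym (mapOut-∘ (number e i) inj₂ (δ⟨ g ⟩ y α)))))))
  rows-correct e@(f ^⟨ b ⟩) i h vs = ≡.trans (rows-correct f i _ vs)
    (cong (_++ vs) (Listₚ.map-cong (λ x → encodeRow-cong (λ α → begin
      mapOut N (δ⟨ f ⟩ x α) ▷ (initial e i α ▷ h α)
        ≡⟨ ▷-assoc (mapOut N (δ⟨ f ⟩ x α)) (initial e i α) (h α) ⟨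
      (mapOut N (δ⟨ f ⟩ x α) ▷ initial e i α) ▷ h α
        ≡⟨ cong (λ o → (mapOut N (δ⟨ f ⟩ x α) ▷ o) ▷ h α) (initial-correct e i α) ⟩
      (mapOut N (δ⟨ f ⟩ x α) ▷ mapOut N (ι⟨ e ⟩ α)) ▷ h α
        ≡⟨ cong (_▷ h α) (mapOut-▷ N (δ⟨ f ⟩ x α) (ι⟨ e ⟩ α)) ⟨
      mapOut N (δ⟨ e ⟩ x α) ▷ h α ∎)) (states f)))
    where
    open ≡-Reasoning
    N = number f i

  index : (e : Exp Act n) → X⟨ e ⟩ ↔ Fin (#Σ e)
  index (act p)      = ↔-sym Finₚ.1↔⊤
  index (bool b)     = ↔-sym Finₚ.0↔⊥
  index (f · g)      = ↔-trans (index f ⊎-↔ index g) (↔-sym Finₚ.+↔⊎)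
  index (f +[ b ] g) = ↔-trans (index f ⊎-↔ index g) (↔-sym Finₚ.+↔⊎)
  index (f ^⟨ b ⟩)   = index f

  -- The inverse bijection goes through `splitAt`, which sends the first `k` indices left and the
  -- remaining `l` right; the tabulation is therefore cut at `k`.
  tabulate-from-⊎ : ∀ {X Y : Set} {k l} (I : X ↔ Fin k) (J : Y ↔ Fin l) {xs ys} →
    tabulate (Inverse.from I) ≡ xs → tabulate (Inverse.from J) ≡ ys →
    tabulate (Inverse.from (↔-trans (I ⊎-↔ J) (↔-sym (Finₚ.+↔⊎ {k} {l})))) ≡ map inj₁ xs ++ map inj₂ ys
  tabulate-from-⊎ {k = k} {l} I J refl refl = ≡.trans (tabulate-+ k _) (cong₂ _++_
    (≡.trans (Listₚ.tabulate-cong (λ i → cong (Sum.map _ _) (Finₚ.splitAt-↑ˡ k i l)))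
      (≡.sym (Listₚ.map-tabulate (Inverse.from I) inj₁)))
    (≡.trans (Listₚ.tabulate-cong (λ i → cong (Sum.map _ _) (Finₚ.splitAt-↑ʳ k l i)))
      (≡.sym (Listₚ.map-tabulate (Inverse.from J) inj₂))))

  tabulate-from : ∀ e → tabulate (Inverse.from (index e)) ≡ states e
  tabulate-from (act p)      = refl
  tabulate-from (bool b)     = refl
  tabulate-from (f · g)      = tabulate-from-⊎ (index f) (index g) (tabulate-from f) (tabulate-from g)
  tabulate-from (f +[ b ] g) = tabulate-from-⊎ (index f) (index g) (tabulate-from f) (tabulate-from g)
  tabulate-from (f ^⟨ b ⟩)   = tabulate-from f

  next-correct : ∀ (e : Exp Act n) i → next e i ≡ i + #Σ e
  next-⊎ : ∀ (f g : Exp Act n) i → next g (next f i) ≡ i + (#Σ f + #Σ g)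

  next-correct (act p)      i = ℕₚ.+-comm 1 i
  next-correct (bool b)     i = ≡.sym (ℕₚ.+-identityʳ i)
  next-correct (f · g)      i = next-⊎ f g i
  next-correct (f +[ b ] g) i = next-⊎ f g i
  next-correct (f ^⟨ b ⟩)   i = next-correct f i

  next-⊎ f g i = ≡.trans (next-correct g (next f i))
    (≡.trans (cong (_+ #Σ g) (next-correct f i)) (ℕₚ.+-assoc i (#Σ f) (#Σ g)))

  -- In a coproduct `index` keeps the left numbers and shifts the right ones by `#Σ f`, which is
  -- exactly how far `next f` advances the counter.
  number-correct : ∀ (e : Exp Act n) i x → number e i x ≡ i + toℕ (Inverse.to (index e) x)
  number-inj₁ : ∀ (f g : Exp Act n) i x →
    number f i x ≡ i + toℕ (Inverse.to (index f) x ↑ˡ #Σ g)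
  number-inj₂ : ∀ (f g : Exp Act n) i y →
    number g (next f i) y ≡ i + toℕ (#Σ f ↑ʳ Inverse.to (index g) y)

  number-correct (act p)      i x        = ≡.sym (ℕₚ.+-identityʳ i)
  number-correct (f · g)      i (inj₁ x) = number-inj₁ f g i x
  number-correct (f · g)      i (inj₂ y) = number-inj₂ f g i y
  number-correct (f +[ b ] g) i (inj₁ x) = number-inj₁ f g i x
  number-correct (f +[ b ] g) i (inj₂ y) = number-inj₂ f g i y
  number-correct (f ^⟨ b ⟩)   i x        = number-correct f i x

  number-inj₁ f g i x =
    ≡.trans (number-correct f i x) (cong (i +_) (≡.sym (Finₚ.toℕ-↑ˡ (Inverse.to (index f) x) (#Σ g))))

  number-inj₂ f g i y = begin
    number g (next f i) y ≡⟨ number-correct g (next f i) y ⟩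
    next f i + toℕ k      ≡⟨ cong (_+ toℕ k) (next-correct f i) ⟩
    (i + #Σ f) + toℕ k    ≡⟨ ℕₚ.+-assoc i (#Σ f) (toℕ k) ⟩
    i + (#Σ f + toℕ k)    ≡⟨ cong (i +_) (Finₚ.toℕ-↑ʳ (#Σ f) k) ⟨
    i + toℕ (#Σ f ↑ʳ k)   ∎
    where
    open ≡-Reasoning
    k = Inverse.to (index g) y

module _ {Act : Set} {n : ℕ} (A : Automaton Act n) {m} (φ : Automaton.State A ↔ Fin m) where
  open Automaton A
  open Inverse φ using (to; from)

  -- The type of outcome-correct mentions a local function of
  -- encodeAutomaton; it is inferred from its use in encodeAutomaton-rows.
  outcome-correct : ∀ i α → _

  encodeAutomaton-rows : encodeAutomaton A φ ≡
    num (toℕ (to start)) ∷ᵥ list (tabulate λ i → encodeRow (mapOut (toℕ ∘ to) ∘ δ (from i)))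
  encodeAutomaton-rows = cong (λ vs → num (toℕ (to start)) ∷ᵥ list vs)
    (Listₚ.tabulate-cong λ i → cong list (Listₚ.map-cong (λ α → outcome-correct i α) (atoms n)))

  outcome-correct i α with δ (from i) α
  ... | reject   = refl
  ... | accept   = refl
  ... | step p x = refl

module _ {Act : Set} {n : ℕ} (e : Exp Act n) where

  -- The start state is the left summand and gets 0, which shifts the others by one and matches a
  -- counter starting at 1.
  numbering : Automaton.State (thompson e) ↔ Fin (1 + #Σ e)
  numbering = ↔-trans (↔-sym Finₚ.1↔⊤ ⊎-↔ index e) (↔-sym Finₚ.+↔⊎)

  number-numbering : ∀ x → toℕ (Inverse.to numbering (inj₂ x)) ≡ number e 1 x
  number-numbering x = ≡.sym (number-correct e 1 x)

  mapOut-numbering : ∀ (o : Out Act X⟨ e ⟩) →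
    mapOut (number e 1) o ≡ mapOut (toℕ ∘ Inverse.to numbering) (mapOut inj₂ o)
  mapOut-numbering o = ≡.sym (≡.trans (mapOut-∘ _ inj₂ o) (mapOut-cong number-numbering o))

  encode-thompson : num 0 ∷ᵥ list (encodeRow (initial e 1) ∷ rows e 1 (const accept) [])
                  ≡ encodeAutomaton (thompson e) numbering
  encode-thompson = ≡.sym (≡.trans (encodeAutomaton-rows (thompson e) numbering)
    -- Tabulation over `Fin (1 + #Σ e)` exposes the row of index 0, that of the start state; the
    -- rest ranges over `index e`.
    (cong₂ (λ r rs → num 0 ∷ᵥ list (r ∷ rs))
      (encodeRow-cong λ α → ≡.sym (≡.trans (initial-correct e 1 α) (mapOut-numbering (ι⟨ e ⟩ α))))
      (begin
        tabulate (stateRow ∘ Inverse.from (index e))       ≡⟨ Listₚ.map-tabulate (Inverse.from (index e)) stateRow ⟨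
        map stateRow (tabulate (Inverse.from (index e)))   ≡⟨ cong (map stateRow) (tabulate-from e) ⟩
        map stateRow (states e)                            ≡⟨ Listₚ.map-cong (λ x → encodeRow-cong (stateRow-correct x)) (states e) ⟩
        map (encodeRow ∘ continued e 1 (const accept)) (states e)       ≡⟨ Listₚ.++-identityʳ _ ⟨
        map (encodeRow ∘ continued e 1 (const accept)) (states e) ++ [] ≡⟨ rows-correct e 1 (const accept) [] ⟨
        rows e 1 (const accept) []                         ∎)))
    where
    open ≡-Reasoning
    stateRow : X⟨ e ⟩ → Val Act
    stateRow x = encodeRow (mapOut (toℕ ∘ Inverse.to numbering) ∘ δι⟨ e ⟩ (inj₂ x))

    stateRow-correct : ∀ x α → mapOut (toℕ ∘ Inverse.to numbering) (δι⟨ e ⟩ (inj₂ x) α)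
                             ≡ continued e 1 (const accept) x α
    stateRow-correct x α = ≡.sym (≡.trans (▷-identityʳ _) (mapOut-numbering (δ⟨ e ⟩ x α)))

-- Linear bounds on the time functions

infix  4 _costs_
infixr 5 _⨟_

-- Uniformity in the credit left over makes bounds add up under composition.
_costs_ : (ℕ → ℕ) → ℕ → Set
U costs x = ∀ k → U k ≤ x + k

_⨟_ : ∀ {U V x y} → U costs x → V costs y → U ∘ V costs x + y
_⨟_ {U} {V} {x} {y} p q k = begin
  U (V k)     ≤⟨ p (V k) ⟩
  x + V k     ≤⟨ ℕₚ.+-monoʳ-≤ x (q k) ⟩
  x + (y + k) ≡⟨ ℕₚ.+-assoc x y k ⟨
  x + y + k   ∎
  where open ℕₚ.≤-Reasoning

pay : ∀ d → (d +_) costs d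
pay d k = ℕₚ.≤-refl

atMost : ∀ {U x y} → x ≤ y → U costs x → U costs y
atMost x≤y p k = ℕₚ.≤-trans (p k) (ℕₚ.+-monoˡ-≤ k x≤y)

-- For times that depend only on the atoms, `U 0` itself can then serve as the constant, without a
-- closed form.
Additive : (ℕ → ℕ) → Set
Additive U = ∀ k → U k ≡ U 0 + k

∘-additive : ∀ {U V} → Additive U → Additive V → Additive (U ∘ V)
∘-additive {U} {V} p q k = begin
  U (V k)         ≡⟨ p (V k) ⟩
  U 0 + V k       ≡⟨ cong (U 0 +_) (q k) ⟩
  U 0 + (V 0 + k) ≡⟨ ℕₚ.+-assoc (U 0) (V 0) k ⟨
  U 0 + V 0 + k   ≡⟨ cong (_+ k) (p (V 0)) ⟨
  U (V 0) + k     ∎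
  where open ≡-Reasoning

+-additive : ∀ d → Additive (d +_)
+-additive d k = cong (_+ k) (≡.sym (ℕₚ.+-identityʳ d))

additive⇒costs : ∀ {U} → Additive U → U costs U 0
additive⇒costs p k = ℕₚ.≤-reflexive (p k)

zipTime-additive : ∀ {A : Set} d (L : List A) → Additive (zipTime d L)
zipTime-additive d []      = +-additive 3
zipTime-additive d (x ∷ L) = ∘-additive (+-additive d) (zipTime-additive d L)

atomTime-additive : ∀ {k} (α : Vec Bool k) → Additive (atomTime α)
atomTime-additive []      = +-additive 1
atomTime-additive (b ∷ α) = ∘-additive (+-additive 2) (atomTime-additive α)

atomsTime-additive : ∀ {k} (L : List (Vec Bool k)) → Additive (atomsTime L)
atomsTime-additive []      = +-additive 1
atomsTime-additive (α ∷ L) =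
  ∘-additive (+-additive 1) (∘-additive (atomTime-additive α) (atomsTime-additive L))

1≤sizeᴮ : ∀ {n} (b : BExp n) → 1 ≤ sizeᴮ b
1≤sizeᴮ 0ᴮ       = s≤s z≤n
1≤sizeᴮ 1ᴮ       = s≤s z≤n
1≤sizeᴮ (prim t) = s≤s z≤n
1≤sizeᴮ (b ·ᴮ c) = s≤s z≤n
1≤sizeᴮ (b +ᴮ c) = s≤s z≤n
1≤sizeᴮ (! b)    = s≤s z≤n

1≤∣_∣ : ∀ {Act n} (e : Exp Act n) → 1 ≤ ∣ e ∣
1≤∣ act p ∣      = s≤s z≤n
1≤∣ bool b ∣     = 1≤sizeᴮ b
1≤∣ f · g ∣      = s≤s z≤n
1≤∣ f +[ b ] g ∣ = s≤s z≤n
1≤∣ f ^⟨ b ⟩ ∣   = s≤s z≤n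

#Σ≤∣_∣ : ∀ {Act n} (e : Exp Act n) → #Σ e ≤ ∣ e ∣
#Σ≤∣ act p ∣      = ℕₚ.≤-refl
#Σ≤∣ bool b ∣     = z≤n
#Σ≤∣ f · g ∣      = ℕₚ.m≤n⇒m≤1+n (ℕₚ.+-mono-≤ #Σ≤∣ f ∣ #Σ≤∣ g ∣)
#Σ≤∣ f +[ b ] g ∣ =
  ℕₚ.m≤n⇒m≤1+n (ℕₚ.+-mono-≤ (ℕₚ.≤-trans #Σ≤∣ f ∣ (ℕₚ.m≤n+m ∣ f ∣ (sizeᴮ b))) #Σ≤∣ g ∣)
#Σ≤∣ f ^⟨ b ⟩ ∣   = ℕₚ.m≤n⇒m≤1+n (ℕₚ.≤-trans #Σ≤∣ f ∣ (ℕₚ.m≤n+m ∣ f ∣ (sizeᴮ b)))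

m≤m*s : ∀ m {s} → 1 ≤ s → m ≤ m * s
m≤m*s m 1≤s = ℕₚ.≤-trans (ℕₚ.≤-reflexive (≡.sym (ℕₚ.*-identityʳ m))) (ℕₚ.*-monoʳ-≤ m 1≤s)

-- Induction step of the linear bounds: of the `suc s` shares of `C`, one pays for the work at the
-- node and the others for its subterms.
node : ∀ C s {d x} → d ≤ C → x ≤ C * s → d + x ≤ C * suc s
node C s d≤C x≤Cs =
  ℕₚ.≤-trans (ℕₚ.+-mono-≤ d≤C x≤Cs) (ℕₚ.≤-reflexive (≡.sym (ℕₚ.*-suc C s)))

leaf : ∀ {d} C → d ≤ C → d ≤ C * 1
leaf C d≤C = ℕₚ.≤-trans d≤C (m≤m*s C ℕₚ.≤-refl)

nthTime-costs : ∀ {n} (i : Fin n) → nthTime i costs 7 * n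
nthTime-costs {suc n} zero    = atMost (ℕₚ.≤-trans (ℕₚ.m≤m+n 5 2) (m≤m*s 7 (s≤s z≤n))) (pay 5)
nthTime-costs {suc n} (suc i) =
  atMost (ℕₚ.≤-reflexive (≡.sym (ℕₚ.*-suc 7 n))) (pay 7 ⨟ nthTime-costs i)

module _ (n : ℕ) where

  private
    -- 23 = 18 + 5 is the cost of `+ᴮ`, the dearest connective; `7 * n` covers looking up a
    -- primitive test.
    B = 23 + 7 * n

  testTime-costs : ∀ (b : BExp n) → testTime b costs B * sizeᴮ b
  testTime-costs 0ᴮ = atMost (leaf B (ℕₚ.m≤m+n 5 _)) (pay 5)
  testTime-costs 1ᴮ = atMost (leaf B (ℕₚ.m≤m+n 7 _)) (pay 7)
  testTime-costs (prim t) =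
    atMost (leaf B (ℕₚ.+-monoˡ-≤ (7 * n) (ℕₚ.m≤m+n 13 10))) (pay 13 ⨟ nthTime-costs t)
  testTime-costs (b ·ᴮ c) = atMost
    (ℕₚ.≤-trans (ℕₚ.≤-reflexive (regroup B (sizeᴮ b) (sizeᴮ c))) (node B (sizeᴮ b + sizeᴮ c) (ℕₚ.m≤m+n 21 _) ℕₚ.≤-refl))
    (pay 16 ⨟ testTime-costs b ⨟ pay 5 ⨟ testTime-costs c)
    where
    regroup : ∀ B s t → 16 + (B * s + (5 + B * t)) ≡ 21 + B * (s + t)
    regroup = solve-∀
  testTime-costs (b +ᴮ c) = atMost
    (ℕₚ.≤-trans (ℕₚ.≤-reflexive (regroup B (sizeᴮ b) (sizeᴮ c))) (node B (sizeᴮ b + sizeᴮ c) (ℕₚ.m≤m+n 23 _) ℕₚ.≤-refl))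
    (pay 18 ⨟ testTime-costs b ⨟ pay 5 ⨟ testTime-costs c)
    where
    regroup : ∀ B s t → 18 + (B * s + (5 + B * t)) ≡ 23 + B * (s + t)
    regroup = solve-∀
  testTime-costs (! b) = atMost
    (ℕₚ.≤-trans (ℕₚ.≤-reflexive (regroup B (sizeᴮ b))) (node B (sizeᴮ b) (ℕₚ.m≤m+n 19 _) ℕₚ.≤-refl))
    (pay 18 ⨟ testTime-costs b ⨟ pay 1)
    where
    regroup : ∀ B s → 18 + (B * s + 1) ≡ 19 + B * s
    regroup = solve-∀

  -- Each atom costs 11 + 6 steps and one evaluation of the test. Here `zipTime` with 0 credit is
  -- just the linear function of the length of `L` with slope `17 + B`.
  selectTime-costs : ∀ (b : BExp n) L → selectTime b L costs zipTime (17 + B) L 0 * sizeᴮ b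
  selectTime-costs b []      = atMost (m≤m*s 3 (1≤sizeᴮ b)) (pay 3)
  selectTime-costs b (α ∷ L) = atMost
    (begin
      11 + (B * s + (6 + S * s)) ≡⟨ regroup B S s ⟩
      17 + (B + S) * s           ≤⟨ ℕₚ.+-monoˡ-≤ _ (m≤m*s 17 (1≤sizeᴮ b)) ⟩
      17 * s + (B + S) * s       ≡⟨ ℕₚ.*-distribʳ-+ s 17 (B + S) ⟨
      (17 + (B + S)) * s         ∎)
    (pay 11 ⨟ testTime-costs b ⨟ pay 6 ⨟ selectTime-costs b L)
    where
    open ℕₚ.≤-Reasoning
    s = sizeᴮ b
    S = zipTime (17 + B) L 0
    regroup : ∀ B S s → 11 + (B * s + (6 + S * s)) ≡ 17 + (B + S) * s
    regroup = solve-∀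

  private
    Fill = zipTime 7 (atoms n) 0
    Seq  = zipTime 11 (atoms n) 0
    Sel  = zipTime (17 + B) (atoms n) 0
    -- 60 exceeds the literals at any node, at most 43 in total; two fills and one sequencing are
    -- the most a node needs, namely at a loop. In `C`, `Sel` is the rate per unit of test size. In
    -- `R`, 25 = 13 + 11 + 1 comes from the product.
    K    = 60 + (Fill + Fill + Seq)
    C    = K + Sel
    R    = 25 + Seq

    fill-costs : fillTime {n} costs Fill
    fill-costs = additive⇒costs (zipTime-additive 7 (atoms n))

    seq-costs : seqTime {n} costs Seq
    seq-costs = additive⇒costs (zipTime-additive 11 (atoms n))

    Sel≤C : Sel ≤ C
    Sel≤C = ℕₚ.m≤n+m Sel K

    overhead : ∀ {d x} → d ≤ 60 → x ≤ Fill + Fill + Seq → d + x ≤ C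
    overhead p q = ℕₚ.≤-trans (ℕₚ.+-mono-≤ p q) (ℕₚ.m≤m+n K Sel)

  annotateTime-costs : ∀ {Act} (e : Exp Act n) → annotateTime e costs C * ∣ e ∣
  annotateTime-costs (act p) = atMost
    (leaf C (ℕₚ.≤-trans (ℕₚ.≤-reflexive (regroup Fill))
      (overhead (ℕₚ.m≤m+n 16 44) (ℕₚ.≤-trans (ℕₚ.m≤m+n Fill Fill) (ℕₚ.m≤m+n _ Seq)))))
    (pay 15 ⨟ fill-costs ⨟ pay 1)
    where
    regroup : ∀ F → 15 + (F + 1) ≡ 16 + F
    regroup = solve-∀
  annotateTime-costs (bool b) = atMost
    (begin
      17 + (Fill + (3 + (Fill + (Sel * s + 1)))) ≡⟨ regroup Fill (Sel * s) ⟩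
      21 + (Fill + Fill) + Sel * s               ≤⟨ ℕₚ.+-monoˡ-≤ (Sel * s) (ℕₚ.+-mono-≤ (ℕₚ.m≤m+n 21 39) (ℕₚ.m≤m+n _ Seq)) ⟩
      -- `bool` adds no node of its own, so the constant work is charged to the size of the test,
      -- which is at least 1.
      K + Sel * s                                ≤⟨ ℕₚ.+-monoˡ-≤ (Sel * s) (m≤m*s K (1≤sizeᴮ b)) ⟩
      K * s + Sel * s                            ≡⟨ ℕₚ.*-distribʳ-+ s K Sel ⟨
      C * s                                      ∎)
    (pay 17 ⨟ fill-costs ⨟ pay 3 ⨟ fill-costs ⨟ selectTime-costs b (atoms n) ⨟ pay 1)
    where
    open ℕₚ.≤-Reasoning
    s = sizeᴮ b
    regroup : ∀ F x → 17 + (F + (3 + (F + (x + 1)))) ≡ 21 + (F + F) + x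
    regroup = solve-∀
  annotateTime-costs (f · g) = atMost
    (ℕₚ.≤-trans (ℕₚ.≤-reflexive (regroup C Seq ∣ f ∣ ∣ g ∣))
      (node C (∣ f ∣ + ∣ g ∣) (overhead (ℕₚ.m≤m+n 41 19) (ℕₚ.m≤n+m Seq _)) ℕₚ.≤-refl))
    (pay 17 ⨟ annotateTime-costs f ⨟ pay 7 ⨟ annotateTime-costs g ⨟ pay 8 ⨟ seq-costs ⨟ pay 9)
    where
    regroup : ∀ C P s t → 17 + (C * s + (7 + (C * t + (8 + (P + 9))))) ≡ 41 + P + C * (s + t)
    regroup = solve-∀
  annotateTime-costs (f +[ b ] g) = atMost
    (begin
      -- The size of the attached test is part of the size of the expression, so selection can be
      -- charged to it at rate `C`.
      21 + (C * s + (7 + (C * t + (10 + (Sel * u + 5))))) ≤⟨ ℕₚ.+-monoʳ-≤ 21 (ℕₚ.+-monoʳ-≤ (C * s) (ℕₚ.+-monoʳ-≤ 7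
                                                               (ℕₚ.+-monoʳ-≤ (C * t) (ℕₚ.+-monoʳ-≤ 10
                                                               (ℕₚ.+-monoˡ-≤ 5 (ℕₚ.*-monoˡ-≤ u Sel≤C)))))) ⟩
      21 + (C * s + (7 + (C * t + (10 + (C * u + 5)))))   ≡⟨ regroup C s t u ⟩
      43 + C * (u + s + t)                                ≤⟨ node C (u + s + t) (overhead (ℕₚ.m≤m+n 43 17) z≤n) ℕₚ.≤-refl ⟩
      C * suc (u + s + t)                                 ∎)
    (pay 21 ⨟ annotateTime-costs f ⨟ pay 7 ⨟ annotateTime-costs g ⨟ pay 10
      ⨟ selectTime-costs b (atoms n) ⨟ pay 5)
    where
    open ℕₚ.≤-Reasoning
    s = ∣ f ∣
    t = ∣ g ∣
    u = sizeᴮ b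
    regroup : ∀ C s t u → 21 + (C * s + (7 + (C * t + (10 + (C * u + 5))))) ≡ 43 + C * (u + s + t)
    regroup = solve-∀
  annotateTime-costs (f ^⟨ b ⟩) = atMost
    (begin
      19 + (C * s + (11 + (Fill + (Seq + (3 + (Fill + (Sel * u + 9)))))))
        ≡⟨ regroup (C * s) Fill Seq (Sel * u) ⟩
      42 + (Fill + Fill + Seq) + (Sel * u + C * s)
        ≤⟨ node C (u + s) (overhead (ℕₚ.m≤m+n 42 18) ℕₚ.≤-refl)
             (ℕₚ.≤-trans (ℕₚ.+-monoˡ-≤ (C * s) (ℕₚ.*-monoˡ-≤ u Sel≤C))
               (ℕₚ.≤-reflexive (≡.sym (ℕₚ.*-distribˡ-+ C u s)))) ⟩
      C * suc (u + s) ∎)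
    (pay 19 ⨟ annotateTime-costs f ⨟ pay 11 ⨟ fill-costs ⨟ seq-costs ⨟ pay 3 ⨟ fill-costs
      ⨟ selectTime-costs b (atoms n) ⨟ pay 9)
    where
    open ℕₚ.≤-Reasoning
    s = ∣ f ∣
    u = sizeᴮ b
    regroup : ∀ x F P y → 19 + (x + (11 + (F + (P + (3 + (F + (y + 9))))))) ≡ 42 + (F + F + P) + (y + x)
    regroup = solve-∀

  rowsTime-costs : ∀ {Act} (e : Exp Act n) → rowsTime e costs R * ∣ e ∣
  rowsTime-costs (act p)  = atMost (leaf R (ℕₚ.m≤m+n 5 _)) (pay 5)
  rowsTime-costs (bool b) = atMost (ℕₚ.≤-trans (ℕₚ.m≤m+n 3 _) (m≤m*s R (1≤sizeᴮ b))) (pay 3)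
  rowsTime-costs (f · g)  = atMost
    (ℕₚ.≤-trans (ℕₚ.≤-reflexive (regroup R Seq ∣ f ∣ ∣ g ∣)) (node R (∣ f ∣ + ∣ g ∣) ℕₚ.≤-refl ℕₚ.≤-refl))
    (pay 13 ⨟ rowsTime-costs g ⨟ pay 11 ⨟ seq-costs ⨟ pay 1 ⨟ rowsTime-costs f)
    where
    regroup : ∀ R P s t → 13 + (R * t + (11 + (P + (1 + R * s)))) ≡ 25 + P + R * (s + t)
    regroup = solve-∀
  rowsTime-costs (f +[ b ] g) = atMost
    (ℕₚ.≤-trans (ℕₚ.≤-reflexive (regroup R ∣ f ∣ ∣ g ∣))
      (node R (sizeᴮ b + ∣ f ∣ + ∣ g ∣) (ℕₚ.m≤m+n 13 _)
        (ℕₚ.*-monoʳ-≤ R (ℕₚ.+-monoˡ-≤ ∣ g ∣ (ℕₚ.m≤n+m ∣ f ∣ (sizeᴮ b))))))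
    (pay 13 ⨟ rowsTime-costs g ⨟ rowsTime-costs f)
    where
    regroup : ∀ R s t → 13 + (R * t + R * s) ≡ 13 + R * (s + t)
    regroup = solve-∀
  rowsTime-costs (f ^⟨ b ⟩) = atMost
    (ℕₚ.≤-trans (ℕₚ.≤-reflexive (regroup Seq (R * ∣ f ∣)))
      (node R (sizeᴮ b + ∣ f ∣) (ℕₚ.+-monoˡ-≤ Seq (ℕₚ.m≤m+n 12 13)) (ℕₚ.*-monoʳ-≤ R (ℕₚ.m≤n+m ∣ f ∣ (sizeᴮ b)))))
    (pay 11 ⨟ seq-costs ⨟ pay 1 ⨟ rowsTime-costs f)
    where
    regroup : ∀ P x → 11 + (P + (1 + x)) ≡ 12 + P + x
    regroup = solve-∀

  mainCost : ℕ
  -- 18 = 1 + 5 + 11 + 1 collects the literals of `mainTime`.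
  mainCost = 18 + (atomsTime (atoms n) 0 + Fill) + (C + R)

  mainTime-costs : ∀ {Act} (e : Exp Act n) → mainTime e costs mainCost * ∣ e ∣
  mainTime-costs e = atMost
    (begin
      1 + (Q + (5 + (C * s + (11 + (Fill + (1 + R * s)))))) ≡⟨ regroup Q Fill C R s ⟩
      18 + (Q + Fill) + (C + R) * s                         ≤⟨ ℕₚ.+-monoˡ-≤ ((C + R) * s) (m≤m*s (18 + (Q + Fill)) 1≤∣ e ∣) ⟩
      (18 + (Q + Fill)) * s + (C + R) * s                   ≡⟨ ℕₚ.*-distribʳ-+ s (18 + (Q + Fill)) (C + R) ⟨
      mainCost * s                                          ∎)
    (pay 1 ⨟ additive⇒costs (atomsTime-additive (atoms n)) ⨟ pay 5 ⨟ annotateTime-costs e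
      ⨟ pay 11 ⨟ fill-costs ⨟ pay 1 ⨟ rowsTime-costs e)
    where
    open ℕₚ.≤-Reasoning
    Q = atomsTime (atoms n) 0
    s = ∣ e ∣
    regroup : ∀ Q F C R s → 1 + (Q + (5 + (C * s + (11 + (F + (1 + R * s))))))
                          ≡ 18 + (Q + F) + (C + R) * s
    regroup = solve-∀

-- Assembly of the result

-- Putting the start state first yields `1 + #Σ e` states; rewriting this as `#Σ e + 1` leaves the
-- encoded table unchanged.
encodeAutomaton-subst : ∀ {Act n} (A : Automaton Act n) {m m′} (eq : m ≡ m′)
  (φ : Automaton.State A ↔ Fin m) →
  encodeAutomaton A (subst (λ k → Automaton.State A ↔ Fin k) eq φ) ≡ encodeAutomaton A φ
encodeAutomaton-subst A refl φ = refl

statesBijection : ∀ {Act n} (e : Exp Act n) → Automaton.State (thompson e) ↔ Fin (#Σ e + 1)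
statesBijection e =
  subst (λ k → Automaton.State (thompson e) ↔ Fin k) (ℕₚ.+-comm 1 (#Σ e)) (numbering e)

program-correct : ∀ {Act n} (e : Exp Act n) → Σ[ k ∈ ℕ ]
  (program n on encode e outputs encodeAutomaton (thompson e) (statesBijection e) inTime k)
    × k ≤ mainCost n * ∣ e ∣
program-correct {Act} {n} e with Runs.main-run n Act {a = 0} e
... | Runs.run {k} d p = k
  , subst (λ w → program n on encode e outputs w inTime k)
      (≡.trans (encode-thompson e) (≡.sym (encodeAutomaton-subst (thompson e) (ℕₚ.+-comm 1 (#Σ e)) (numbering e)))) d
  , (begin
      k                        ≡⟨ ℕₚ.+-identityʳ k ⟨
      k + 0                    ≤⟨ p ⟩
      mainTime e 0             ≤⟨ mainTime-costs n e 0 ⟩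
      mainCost n * ∣ e ∣ + 0   ≡⟨ ℕₚ.+-identityʳ _ ⟩
      mainCost n * ∣ e ∣       ∎)
  where open ℕₚ.≤-Reasoning

proposition4p2 : (n : ℕ) → .{{_ : NonZero n}} →
    (Σ[ P ∈ Program ] Σ[ c ∈ ℕ ] ({Act : Set} → Act → (e : Exp Act n) →
    Σ[ φ ∈ Automaton.State (thompson e) ↔ Fin (#Σ e + 1) ] Σ[ k ∈ ℕ ]
    (P on encode e outputs encodeAutomaton (thompson e) φ inTime k) × k ≤ c * ∣ e ∣))
    × ({Act : Set} → Act → (e : Exp Act n) →
    Automaton.State (thompson e) ↔ Fin (#Σ e + 1))
    × (Σ[ c ∈ ℕ ] ({Act : Set} → Act → (e : Exp Act n) →
    #Σ e + 1 ≤ c * ∣ e ∣))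
proposition4p2 n =
    (program n , mainCost n , λ _ e → statesBijection e , program-correct e)
  , (λ _ e → statesBijection e)
  -- One copy of the size bounds the number of actions, the other the start state.
  , 2 , λ _ e → ℕₚ.+-mono-≤ #Σ≤∣ e ∣ (ℕₚ.≤-trans 1≤∣ e ∣ (ℕₚ.m≤m+n ∣ e ∣ 0))
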